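{- For every finite undirected graph $G$, $$i_g(G) \le \left\lfloor \frac{3\Delta(G) - a(G)}{2} \right\rfloor + 8a(G) - 1,$$ where $\Delta(G)$ is the maximum degree of $G$, $a(G)$ is the arboricity of $G$, and $i_g(G)$ is the incidence game chromatic number of $G$.
   Context: An incidence of a graph $G$ is a pair $(v,e)$ where $v$ is a vertex and $e$ an edge of $G$ incident to $v$. Two incidences $(v,e)$ and $(w,f)$ are adjacent if $v=w$, or $e=f$, or the edge $vw$ equals $e$ or $f$. The incidence coloring game on $G$ with a given set of $k$ colors is played by two players, Alice and Bob, who alternately (Alice first) choose an uncolored incidence of $G$ and assign it a color from the set so that no two adjacent incidences receive the same color. Alice wins if eventually all incidences of $G$ are colored; Bob wins otherwise (i.e. if at some point some uncolored incidence has no available color). The incidence game chromatic number $i_g(G)$ is the smallest $k$ for which Alice has a winning strategy in this game with $k$ colors. The arboricity $a(G)$ is the minimum number of forests into which the edge set of $G$ can be partitioned. -}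

module Defs where

open import Data.Nat using (ℕ; zero; suc; _+_; _*_; _∸_; _≤_; _⊔_; _/_)
open import Data.Fin using (Fin; zero; suc; inject₁; fromℕ; _≟_)
open import Data.Fin.Properties using ()
open import Data.List using (List; map; foldr; allFin)
open import Data.Nat.ListAction using (sum)
open import Data.Bool using (Bool; true; false; if_then_else_)
open import Data.Maybe using (Maybe; just; nothing)
open import Data.Product using (Σ; ∃; _×_; _,_)
open import Data.Sum using (_⊎_)
open import Data.Empty using (⊥)
open import Relation.Nullary using (¬_; does)
open import Relation.Binary.PropositionalEquality using (_≡_; _≢_)
open import Function.Definitions using (Injective)

record Graph : Set where
  field
    n      : ℕ
    adj    : Fin n → Fin n → Bool
    sym    : ∀ u v → adj u v ≡ adj v u
    irrefl : ∀ v → adj v v ≡ false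
open Graph public

degree : (G : Graph) → Fin (n G) → ℕ
degree G v = sum (map (λ w → if adj G v w then 1 else 0) (allFin (n G)))

maxDegree : Graph → ℕ
maxDegree G = foldr _⊔_ 0 (map (degree G) (allFin (n G)))

Cycle : {m : ℕ} → (Fin m → Fin m → Set) → Set
Cycle {m} E =
  Σ ℕ λ l → Σ (Fin (suc (suc (suc l))) → Fin m) λ c →
    Injective _≡_ _≡_ c
    × (∀ (i : Fin (suc (suc l))) → E (c (inject₁ i)) (c (suc i)))
    × E (c (fromℕ (suc (suc l)))) (c zero)

ForestPartition : (G : Graph) → ℕ → Set
ForestPartition G k =
  Σ (Fin (n G) → Fin (n G) → Fin k) λ col →
    (∀ u v → adj G u v ≡ true → col u v ≡ col v u)
    × (∀ (i : Fin k) → ¬ Cycle (λ u v → adj G u v ≡ true × col u v ≡ i))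

IsArboricity : Graph → ℕ → Set
IsArboricity G a = ForestPartition G a × (∀ k → ForestPartition G k → a ≤ k)

-- Incidence coloring game.
-- An incidence (v, e) with e = vw is represented by the ordered pair (v , w)
-- with adj v w ≡ true.

module Game (G : Graph) (k : ℕ) where
  V : Set
  V = Fin (n G)

  Inc : V → V → Set
  Inc u v = adj G u v ≡ true

  -- (u, uv) and (x, xy) are adjacent: distinct, and u = x, or uv = xy
  -- as edges, or the edge ux equals uv or xy.
  IncAdj : V → V → V → V → Set
  IncAdj u v x y =
    ¬ (u ≡ x × v ≡ y) ×
    (u ≡ x ⊎ (u ≡ y × v ≡ x) ⊎ v ≡ x ⊎ u ≡ y)

  -- partial colorings (only values on incidences matter)
  Coloring : Set
  Coloring = V → V → Maybe (Fin k)

  empty : Coloring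
  empty _ _ = nothing

  update : Coloring → V → V → Fin k → Coloring
  update c u v α x y =
    if does (u ≟ x) then (if does (v ≟ y) then just α else c x y) else c x y

  Uncolored : Coloring → V → V → Set
  Uncolored c u v = Inc u v × c u v ≡ nothing

  Legal : Coloring → V → V → Fin k → Set
  Legal c u v α = ∀ x y → Inc x y → IncAdj u v x y → c x y ≢ just α

  Complete : Coloring → Set
  Complete c = ∀ u v → Inc u v → c u v ≢ nothing

  Blocked : Coloring → Set
  Blocked c = Σ V λ u → Σ V λ v → Uncolored c u v × (∀ α → ¬ Legal c u v α)

  mutual
    data AliceWins (c : Coloring) : Set where
      finished : Complete c → AliceWins c
      move     : ¬ Blocked c → (u v : V) (α : Fin k) →
                 Uncolored c u v → Legal c u v α →
                 BobMoveWins (update c u v α) → AliceWins c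

    data BobMoveWins (c : Coloring) : Set where
      finished : Complete c → BobMoveWins c
      respond  : ¬ Blocked c →
                 ((u v : V) (α : Fin k) → Uncolored c u v → Legal c u v α →
                   AliceWins (update c u v α)) →
                 BobMoveWins c

AliceHasWinningStrategy : Graph → ℕ → Set
AliceHasWinningStrategy G k = Game.AliceWins G k (Game.empty G k)

{-# OPTIONS --safe #-}
module Submission where

-- Orient every forest so that each vertex has at most one parent in it; then every vertex has at
-- most a parents. The two incidences of an arc x → p are charged to x, and Alice keeps a set of marked
-- incidences containing the coloured ones. When Bob colours an incidence of x → p, she climbs from p:
-- at a vertex v she picks an uncoloured incidence of an arc v → q, those at q first, and colours it if
-- it is marked; otherwise she marks it and goes on from q. Every visit to v uses up one of the at most
-- two steps (marking, colouring) of an incidence charged to v, so while an incidence at a parent of v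
-- is uncoloured at most 2a incidences of arcs into v are marked, and at most 4a while any incidence
-- charged to v is uncoloured. Thus few colours are forbidden by the children of v, and beyond
-- M = 6a − 1 colours on the incidences (s , sp) of the children s of p one of these colours can always
-- be reused. Once that many occur, Alice answers each new such colour by reusing an old one, so their
-- number stays near (M + #children) / 2; this is the source of 3Δ/2 instead of 2Δ.

open import Defs hiding (sym)
open import Data.Nat using (ℕ; zero; suc; _+_; _*_; _∸_; _≤_; _<_; _/_; z≤n; s≤s; s≤s⁻¹; _⊔_)
import Data.Nat as ℕ
import Data.Nat.Properties as ℕₚ
open import Data.Nat.Properties hiding (_≟_; _<?_; <-asym; <-cmp)
open import Data.Nat.DivMod using (/-monoˡ-≤; m*n/n≡m; +-distrib-/-∣ʳ)
open import Data.Nat.Divisibility using (n∣m*n)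
open import Data.Nat.Tactic.RingSolver using (solve-∀)
open import Data.Nat.ListAction using (sum)
open import Data.Bool using (Bool; true; false; if_then_else_; _∧_; _∨_; not; T)
import Data.Bool as Bool
open import Data.Bool.Properties using (∨-zeroʳ)
open import Data.Empty using (⊥; ⊥-elim)
open import Data.Fin using (Fin; zero; suc; toℕ; fromℕ; inject₁; _≟_; _<?_)
open import Data.Fin.Properties using (any?; pigeonhole; toℕ-inject₁; toℕ-fromℕ; <-asym; <-cmp; toℕ<n)
open import Data.List using (List; []; _∷_; map; allFin; foldr)
open import Data.List.Properties using (map-tabulate)
open import Data.List.Membership.Propositional using (_∈_)
open import Data.List.Membership.Propositional.Properties using (∈-allFin)
open import Data.List.Relation.Unary.Any using (here; there)
open import Data.Maybe using (Maybe; just; nothing; is-just)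
open import Data.Maybe.Properties using (just-injective) renaming (≡-dec to maybe-≡-dec)
open import Data.Product using (Σ; ∃; ∃₂; _×_; _,_; proj₁; proj₂)
open import Data.Sum using (_⊎_; inj₁; inj₂; [_,_])
open import Function using (_∘_; id; case_of_)
open import Relation.Binary using (tri<; tri≈; tri>)
open import Relation.Nullary using (¬_; Dec; yes; no; does; contradiction; ¬?; _×-dec_; _⊎-dec_)
open import Relation.Nullary.Decidable using (dec-true; dec-false)
open import Relation.Binary.PropositionalEquality using (_≡_; _≢_; refl; sym; trans; cong; subst; subst₂)

-- Booleans and decidable tests

∧-true⁺ : ∀ {b b′} → b ≡ true → b′ ≡ true → b ∧ b′ ≡ true
∧-true⁺ refl refl = refl

∧-true⁻ : ∀ {b b′} → b ∧ b′ ≡ true → b ≡ true × b′ ≡ true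
∧-true⁻ {true} {true} refl = refl , refl

∨-true⁻ : ∀ {b b′} → b ∨ b′ ≡ true → b ≡ true ⊎ b′ ≡ true
∨-true⁻ {true}  _ = inj₁ refl
∨-true⁻ {false} p = inj₂ p

true≢false : ∀ {b} → b ≡ true → b ≡ false → ⊥
true≢false refl ()

not-true : ∀ {b} → not b ≡ true → b ≢ true
not-true {false} _ ()

not-false : ∀ {b} → b ≢ true → not b ≡ true
not-false {false} _ = refl
not-false {true}  h = contradiction refl h

not-antimono : ∀ {b b′} → (b ≡ true → b′ ≡ true) → not b′ ≡ true → not b ≡ true
not-antimono h n = not-false (not-true n ∘ h)

T⇒true : ∀ {b} → T b → b ≡ true
T⇒true {true} _ = refl

does-sound : ∀ {A : Set} (d : Dec A) → does d ≡ true → A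
does-sound (yes a) _ = a

-- Counting

𝟙 : Bool → ℕ
𝟙 b = if b then 1 else 0

𝟙-mono : ∀ {b b′} → (b ≡ true → b′ ≡ true) → 𝟙 b ≤ 𝟙 b′
𝟙-mono {false} _ = z≤n
𝟙-mono {true}  h rewrite h refl = ≤-refl

_==_ : ∀ {n} → Fin n → Fin n → Bool
x == y = does (x ≟ y)

==-refl : ∀ {n} (x : Fin n) → (x == x) ≡ true
==-refl x = dec-true (x ≟ x) refl

==-sound : ∀ {n} {x y : Fin n} → (x == y) ≡ true → x ≡ y
==-sound {x = x} {y} = does-sound (x ≟ y)

==-suc : ∀ {n} (x y : Fin n) → (Fin.suc x == suc y) ≡ (x == y)
==-suc x y with x ≟ y
... | yes _ = refl
... | no _  = refl

opaque

  ∑ : ∀ {n} → (Fin n → ℕ) → ℕ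
  ∑ {n} f = sum (map f (allFin n))

  ∑-mono : ∀ {n} {f g : Fin n → ℕ} → (∀ x → f x ≤ g x) → ∑ f ≤ ∑ g
  ∑-mono {n} {f} {g} f≤g = go (allFin n)
    where
    go : ∀ xs → sum (map f xs) ≤ sum (map g xs)
    go []       = z≤n
    go (x ∷ xs) = +-mono-≤ (f≤g x) (go xs)

  ∑-+ : ∀ {n} (f g : Fin n → ℕ) → ∑ (λ x → f x + g x) ≡ ∑ f + ∑ g
  ∑-+ {n} f g = go (allFin n)
    where
    interchange : ∀ a b c d → a + b + (c + d) ≡ a + c + (b + d)
    interchange = solve-∀
    go : ∀ xs → sum (map (λ x → f x + g x) xs) ≡ sum (map f xs) + sum (map g xs)
    go []       = refl
    go (x ∷ xs) rewrite go xs = interchange (f x) (g x) _ _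

  ∑-suc : ∀ {n} (f : Fin (suc n) → ℕ) → ∑ f ≡ f zero + ∑ (f ∘ suc)
  ∑-suc {n} f = cong (λ xs → f zero + sum xs)
    (trans (map-tabulate suc f) (sym (map-tabulate id (f ∘ suc))))

  # : ∀ {n} → (Fin n → Bool) → ℕ
  # P = ∑ (λ x → 𝟙 (P x))

  degree≡# : ∀ G v → degree G v ≡ # (adj G v)
  degree≡# G v = refl

  #-empty : (P : Fin 0 → Bool) → # P ≡ 0
  #-empty P = refl

  #-suc : ∀ {n} (P : Fin (suc n) → Bool) → # P ≡ 𝟙 (P zero) + # (P ∘ suc)
  #-suc P = ∑-suc (λ x → 𝟙 (P x))

  #-mono : ∀ {n} {P Q : Fin n → Bool} → (∀ x → P x ≡ true → Q x ≡ true) → # P ≤ # Q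
  #-mono P⊆Q = ∑-mono (λ x → 𝟙-mono (P⊆Q x))

  #-∪ : ∀ {n} {P Q R : Fin n → Bool} →
        (∀ x → P x ≡ true → Q x ≡ true ⊎ R x ≡ true) → # P ≤ # Q + # R
  #-∪ {n} {P} {Q} {R} h = ≤-trans (∑-mono pointwise) (≤-reflexive (∑-+ {n} _ _))
    where
    pointwise : ∀ x → 𝟙 (P x) ≤ 𝟙 (Q x) + 𝟙 (R x)
    pointwise x with P x | h x
    ... | false | _ = z≤n
    ... | true  | h′ with h′ refl
    ...   | inj₁ q rewrite q = s≤s z≤n
    ...   | inj₂ r rewrite r = m≤n+m 1 _

  #-⊎ : ∀ {n} {P Q R : Fin n → Bool} →
        (∀ x → Q x ≡ true → P x ≡ true) → (∀ x → R x ≡ true → P x ≡ true) →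
        (∀ x → Q x ≡ true → R x ≢ true) → # Q + # R ≤ # P
  #-⊎ {n} {P} {Q} {R} Q⊆P R⊆P Q∩R = ≤-trans (≤-reflexive (sym (∑-+ {n} _ _))) (∑-mono pointwise)
    where
    pointwise : ∀ x → 𝟙 (Q x) + 𝟙 (R x) ≤ 𝟙 (P x)
    pointwise x with Q x | R x | Q⊆P x | R⊆P x | Q∩R x
    ... | true  | true  | _   | _   | q∩r = contradiction refl (q∩r refl)
    ... | true  | false | q⊆p | _   | _ rewrite q⊆p refl = ≤-refl
    ... | false | true  | _   | r⊆p | _ rewrite r⊆p refl = ≤-refl
    ... | false | false | _   | _   | _ = z≤n

#-cong : ∀ {n} {P Q : Fin n → Bool} → (∀ x → P x ≡ Q x) → # P ≡ # Q
#-cong P≡Q = ≤-antisym (#-mono (λ x → trans (sym (P≡Q x)))) (#-mono (λ x → trans (P≡Q x)))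

#-all : ∀ n → # {n} (λ _ → true) ≡ n
#-all zero    = #-empty _
#-all (suc n) = trans (#-suc {n} (λ _ → true)) (cong suc (#-all n))

#-none : ∀ n → # {n} (λ _ → false) ≡ 0
#-none zero    = #-empty _
#-none (suc n) = trans (#-suc {n} (λ _ → false)) (#-none n)

#-singleton : ∀ {n} (x : Fin n) → # (x ==_) ≡ 1
#-singleton {suc n} zero    = trans (#-suc {n} (zero ==_)) (cong suc (#-none n))
#-singleton {suc n} (suc x) = trans (#-suc {n} (suc x ==_))
  (trans (#-cong (==-suc x)) (#-singleton x))

opaque
  unfolding ∑

  ∑-strict : ∀ {n} {f g : Fin n → ℕ} (x : Fin n) → (∀ z → f z ≤ g z) → f x < g x → ∑ f < ∑ g
  ∑-strict {n} {f} {g} x f≤g fx<gx = begin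
    suc (∑ f)                     ≡⟨ +-comm 1 (∑ f) ⟩
    ∑ f + 1                       ≡⟨ cong (∑ f +_) (#-singleton x) ⟨
    ∑ f + # (x ==_)               ≡⟨ ∑-+ f (λ z → 𝟙 (x == z)) ⟨
    ∑ (λ z → f z + 𝟙 (x == z))    ≤⟨ ∑-mono pointwise ⟩
    ∑ g                           ∎
    where
    open ≤-Reasoning
    pointwise : ∀ z → f z + 𝟙 (x == z) ≤ g z
    pointwise z with x ≟ z
    ... | yes refl = ≤-trans (≤-reflexive (+-comm (f x) 1)) fx<gx
    ... | no _     = ≤-trans (≤-reflexive (+-identityʳ (f z))) (f≤g z)

module _ {n : ℕ} where

  #-insert : {P Q : Fin n → Bool} (y : Fin n) →
             (∀ x → P x ≡ true → Q x ≡ true ⊎ y ≡ x) → # P ≤ suc (# Q)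
  #-insert {P} {Q} y h = begin
    # P              ≤⟨ #-∪ (λ x p → [ inj₁ , (λ { refl → inj₂ (==-refl y) }) ] (h x p)) ⟩
    # Q + # (y ==_)  ≡⟨ cong (# Q +_) (#-singleton y) ⟩
    # Q + 1          ≡⟨ +-comm (# Q) 1 ⟩
    suc (# Q)        ∎
    where open ≤-Reasoning

  #-strict : {P Q : Fin n → Bool} (y : Fin n) → (∀ x → P x ≡ true → Q x ≡ true) →
             P y ≢ true → Q y ≡ true → # P < # Q
  #-strict {P} {Q} y P⊆Q ¬p q = begin
    suc (# P)        ≡⟨ +-comm 1 (# P) ⟩
    # P + 1          ≡⟨ cong (# P +_) (sym (#-singleton y)) ⟩
    # P + # (y ==_)  ≤⟨ #-⊎ P⊆Q (λ x e → subst (λ z → Q z ≡ true) (==-sound e) q)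
                            (λ x p e → ¬p (subst (λ z → P z ≡ true) (sym (==-sound e)) p)) ⟩
    # Q              ∎
    where open ≤-Reasoning

  choose : {P Q : Fin n → Bool} → # P < # Q → ∃ λ x → Q x ≡ true × P x ≢ true
  choose {P} {Q} P<Q with any? (λ x → (Q x Bool.≟ true) ×-dec ¬? (P x Bool.≟ true))
  ... | yes found = found
  ... | no ¬found = contradiction (#-mono Q⊆P) (<⇒≱ P<Q)
    where
    Q⊆P : ∀ x → Q x ≡ true → P x ≡ true
    Q⊆P x q with P x Bool.≟ true
    ... | yes p = p
    ... | no ¬p = contradiction (x , q , ¬p) ¬found

opaque

  -- Sets of colours are Boolean predicates, so that forbidden colours can be counted; elements
  -- whose value is `nothing` contribute no colour.
  image : ∀ {n k} → (Fin n → Bool) → (Fin n → Maybe (Fin k)) → Fin k → Bool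
  image Q f α = does (any? λ z → (Q z Bool.≟ true) ×-dec maybe-≡-dec _≟_ (f z) (just α))

  image⁺ : ∀ {n k} (Q : Fin n → Bool) (f : Fin n → Maybe (Fin k)) {α} z →
           Q z ≡ true → f z ≡ just α → image Q f α ≡ true
  image⁺ Q f z q e = dec-true (any? _) (z , q , e)

  image⁻ : ∀ {n k} (Q : Fin n → Bool) (f : Fin n → Maybe (Fin k)) {α} →
           image Q f α ≡ true → ∃ λ z → Q z ≡ true × f z ≡ just α
  image⁻ Q f = does-sound (any? _)

#-image : ∀ {n k} (Q : Fin n → Bool) (f : Fin n → Maybe (Fin k)) →
          # (image Q f) ≤ # (λ z → Q z ∧ is-just (f z))
#-image {zero}  {k} Q f = ≤-trans (#-mono {Q = λ _ → false} (λ α i → case image⁻ Q f {α} i of λ ()))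
                                  (≤-trans (≤-reflexive (#-none k)) z≤n)
#-image {suc n} {k} Q f = begin
  # (image Q f)                                       ≤⟨ bound (Q zero) (f zero) refl refl ⟩
  𝟙 (Q zero ∧ is-just (f zero)) + # (image (Q ∘ suc) (f ∘ suc))
    ≤⟨ +-monoʳ-≤ (𝟙 (Q zero ∧ is-just (f zero))) (#-image (Q ∘ suc) (f ∘ suc)) ⟩
  𝟙 (Q zero ∧ is-just (f zero)) + # (λ z → Q (suc z) ∧ is-just (f (suc z)))
    ≡⟨ #-suc {n} _ ⟨
  # (λ z → Q z ∧ is-just (f z))                       ∎
  where
  open ≤-Reasoning
  rest : Fin k → Bool
  rest = image (Q ∘ suc) (f ∘ suc)
  bound : ∀ q fz → Q zero ≡ q → f zero ≡ fz → # (image Q f) ≤ 𝟙 (q ∧ is-just fz) + # rest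
  bound true (just β) _ f≡ = #-insert β λ α i → case image⁻ Q f i of λ where
    (zero  , _ , e) → inj₂ (just-injective (trans (sym f≡) e))
    (suc z , q , e) → inj₁ (image⁺ (Q ∘ suc) (f ∘ suc) z q e)
  bound true nothing _ f≡ = #-mono λ α i → case image⁻ Q f i of λ where
    (zero  , _ , e) → case trans (sym f≡) e of λ ()
    (suc z , q , e) → image⁺ (Q ∘ suc) (f ∘ suc) z q e
  bound false _ Q≡ _ = #-mono λ α i → case image⁻ Q f i of λ where
    (zero  , q , e) → ⊥-elim (true≢false q Q≡)
    (suc z , q , e) → image⁺ (Q ∘ suc) (f ∘ suc) z q e

degree≤maxDegree : (G : Graph) (v : Fin (n G)) → degree G v ≤ maxDegree G
degree≤maxDegree G v = go (∈-allFin v)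
  where
  go : ∀ {xs} → v ∈ xs → degree G v ≤ foldr _⊔_ 0 (map (degree G) xs)
  go (here refl)            = m≤m⊔n _ _
  go {x ∷ _} (there v∈xs)   = ≤-trans (go v∈xs) (m≤n⊔m (degree G x) _)

-- Orientations

record Orientation (G : Graph) (a : ℕ) : Set where
  field
    arc       : Fin (n G) → Fin (n G) → Bool
    arc⇒adj   : ∀ {u v} → arc u v ≡ true → adj G u v ≡ true
    adj⇒arc   : ∀ {u v} → adj G u v ≡ true → arc u v ≡ true ⊎ arc v u ≡ true
    arc-asym  : ∀ {u v} → arc u v ≡ true → arc v u ≢ true
    outdegree : ∀ v → # (arc v) ≤ a

module _ {m : ℕ} (E : Fin m → Fin m → Set) (E-irrefl : ∀ v → ¬ E v v) where

  -- A shortest closed stretch of a non-backtracking walk is a cycle.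
  module _ (w : ℕ → Fin m) (w-step : ∀ i → E (w i) (w (suc i)))
           (w-turn : ∀ i → w (suc (suc i)) ≢ w i) where

    closed⇒cycle : ∀ fuel i d → d ≤ fuel → 0 < d → w i ≡ w (i + d) → Cycle E
    -- Length one would be a loop, and length two (next clause) an immediate return.
    closed⇒cycle (suc fuel) i (suc zero) _ _ e =
      ⊥-elim (E-irrefl (w i) (subst (E (w i)) (sym (trans e (cong w (+-comm i 1)))) (w-step i)))
    closed⇒cycle (suc fuel) i (suc (suc zero)) _ _ e =
      ⊥-elim (w-turn i (sym (trans e (cong w (+-comm i 2)))))
    -- The search covers the positions before the closing one, so a repetition gives a strictly
    -- shorter closed stretch; without one the positions form the cycle.
    closed⇒cycle (suc fuel) i (suc (suc (suc l))) (s≤s l≤fuel) _ e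
      with any? {suc (suc (suc l))} (λ s → any? {suc (suc (suc l))} (λ t →
             (s <? t) ×-dec (w (i + toℕ s) ≟ w (i + toℕ t))))
    ... | yes (s , t , s<t , ws≡wt) =
      closed⇒cycle fuel (i + toℕ s) (toℕ t ∸ toℕ s)
        (≤-trans (≤-trans (m∸n≤m (toℕ t) (toℕ s)) (s≤s⁻¹ (toℕ<n t))) l≤fuel)
        (m<n⇒0<n∸m s<t)
        (trans ws≡wt (cong w (sym (trans (+-assoc i (toℕ s) _)
          (cong (i +_) (trans (+-comm (toℕ s) _) (m∸n+n≡m (<⇒≤ s<t))))))))
    ... | no ¬rep = l , c , c-inj , c-step , c-close
      where
      c : Fin (suc (suc (suc l))) → Fin m
      c t = w (i + toℕ t)
      c-inj : ∀ {s t} → c s ≡ c t → s ≡ t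
      c-inj {s} {t} e′ with <-cmp s t
      ... | tri< s<t _ _ = contradiction (s , t , s<t , e′) ¬rep
      ... | tri≈ _ s≡t _ = s≡t
      ... | tri> _ _ t<s = contradiction (t , s , t<s , sym e′) ¬rep
      c-step : ∀ (t : Fin (suc (suc l))) → E (c (inject₁ t)) (c (suc t))
      c-step t = subst₂ E (cong (λ z → w (i + z)) (sym (toℕ-inject₁ t)))
                          (cong w (sym (+-suc i (toℕ t)))) (w-step (i + toℕ t))
      c-close : E (c (fromℕ (suc (suc l)))) (c zero)
      c-close = subst₂ E (cong (λ z → w (i + z)) (sym (toℕ-fromℕ (suc (suc l)))))
        (trans (cong w (sym (+-suc i (suc (suc l))))) (trans (sym e) (cong w (sym (+-identityʳ i)))))
        (w-step (i + suc (suc l)))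

    walk⇒cycle : Cycle E
    walk⇒cycle with pigeonhole (n<1+n m) (w ∘ toℕ)
    ... | i , j , i<j , wi≡wj =
      closed⇒cycle (toℕ j ∸ toℕ i) (toℕ i) (toℕ j ∸ toℕ i) ≤-refl (m<n⇒0<n∸m i<j)
        (trans wi≡wj (cong w (sym (trans (+-comm (toℕ i) _) (m∸n+n≡m (<⇒≤ i<j))))))

  module _ (E? : ∀ u v → Dec (E u v)) (E-sym : ∀ {u v} → E u v → E v u) where

    Fork : (Fin m → Bool) → Fin m → Set
    Fork R v = ∃₂ λ y z → (R y ≡ true × E v y) × (R z ≡ true × E v z) × y ≢ z

    Fork? : ∀ R v → Dec (Fork R v)
    Fork? R v = any? λ y → any? λ z →
      ((R y Bool.≟ true) ×-dec E? v y) ×-dec ((R z Bool.≟ true) ×-dec E? v z) ×-dec ¬? (y ≟ z)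

    -- A fork offers two ways on, so a walk inside `R` can always leave a vertex by a neighbour
    -- other than the one it came from.
    forks⇒cycle : ∀ R r → R r ≡ true → (∀ v → R v ≡ true → Fork R v) → Cycle E
    forks⇒cycle R r Rr fork = walk⇒cycle w (λ i → proj₂ (proj₂ (proj₂ (walk i)))) turn
      where
      Step : Set
      Step = ∃₂ λ u v → R v ≡ true × E u v
      extend : (s : Step) → ∃ λ y → (R y ≡ true × E (proj₁ (proj₂ s)) y) × y ≢ proj₁ s
      extend (u , v , Rv , _) with fork v Rv
      ... | y , z , hy , hz , y≢z with y ≟ u
      ...   | no y≢u   = y , hy , y≢u
      ...   | yes refl = z , hz , y≢z ∘ sym
      walk : ℕ → Step
      walk zero with fork r Rr
      ... | y , _ , (Ry , Ey) , _ = r , y , Ry , Ey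
      walk (suc i) with walk i
      ... | s@(u , v , _) with extend s
      ...   | y , (Ry , Ey) , _ = v , y , Ry , Ey
      w : ℕ → Fin m
      w = proj₁ ∘ walk
      turn : ∀ i → w (suc (suc i)) ≢ w i
      turn i with walk i
      ... | s with extend s
      ...   | y , _ , y≢u = y≢u

    -- Every edge inside `R` is claimed by an end that takes the other end as its only parent; this
    -- yields one out-neighbour per vertex and forest.
    ParentMap : (Fin m → Bool) → Set
    ParentMap R = Σ (Fin m → Maybe (Fin m)) λ par →
      ∀ u v → R u ≡ true → R v ≡ true → E u v → par u ≡ just v ⊎ par v ≡ just u

    -- Peel off vertices of degree at most one.
    parentMap : ¬ Cycle E → ∀ fuel R → # R ≤ fuel → ParentMap R
    parentMap acyclic fuel R R≤ with any? (λ v → (R v Bool.≟ true) ×-dec ¬? (Fork? R v))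
    -- If every vertex of `R` has a fork, acyclicity forces `R` to be empty, so any map will do.
    parentMap acyclic fuel R R≤ | no ¬leaf = (λ _ → nothing) , λ u v Ru _ _ →
      ⊥-elim (acyclic (forks⇒cycle R u Ru fork))
      where
      fork : ∀ v → R v ≡ true → Fork R v
      fork v Rv with Fork? R v
      ... | yes f = f
      ... | no ¬f = contradiction (v , Rv , ¬f) ¬leaf
    parentMap acyclic zero R R≤ | yes (v , Rv , _) =
      contradiction (≤-trans (#-strict {P = λ _ → false} v (λ _ ()) (λ ()) Rv) R≤) n≮0
    parentMap acyclic (suc fuel) R R≤ | yes (v , Rv , ¬fork) = par′ , spec′
      where
      R′ : Fin m → Bool
      R′ x = R x ∧ not (v == x)
      R′⁺ : ∀ {x} → R x ≡ true → v ≢ x → R′ x ≡ true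
      R′⁺ {x} Rx v≢x = ∧-true⁺ Rx (cong not (dec-false (v ≟ x) v≢x))
      R′<R : # R′ < # R
      R′<R = #-strict v (λ x → proj₁ ∘ ∧-true⁻)
        (λ p → case trans (sym (proj₂ (∧-true⁻ {R v} p))) (cong not (==-refl v)) of λ ()) Rv
      rec : ParentMap R′
      rec = parentMap acyclic fuel R′ (s≤s⁻¹ (≤-trans R′<R R≤))
      par-v : Maybe (Fin m)
      par-v with any? (λ y → (R y Bool.≟ true) ×-dec E? v y)
      ... | yes (y , _) = just y
      ... | no _        = nothing
      -- Without a fork, `v` has at most one neighbour in `R`, so the search can only have found
      -- `y`.
      par-v-spec : ∀ y → R y ≡ true → E v y → par-v ≡ just y
      par-v-spec y Ry Ey with any? (λ y → (R y Bool.≟ true) ×-dec E? v y)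
      ... | no ¬y = contradiction (y , Ry , Ey) ¬y
      ... | yes (z , hz) with z ≟ y
      ...   | yes z≡y = cong just z≡y
      ...   | no z≢y  = contradiction (z , y , hz , (Ry , Ey) , z≢y) ¬fork
      par′ : Fin m → Maybe (Fin m)
      par′ x = if v == x then par-v else proj₁ rec x
      spec′ : ∀ x y → R x ≡ true → R y ≡ true → E x y → par′ x ≡ just y ⊎ par′ y ≡ just x
      spec′ x y Rx Ry Exy with v ≟ x | v ≟ y
      ... | yes refl | _        = inj₁ (par-v-spec y Ry Exy)
      ... | no _     | yes refl = inj₂ (par-v-spec x Rx (E-sym Exy))
      ... | no v≢x   | no v≢y   = proj₂ rec x y (R′⁺ Rx v≢x) (R′⁺ Ry v≢y) Exy

-- Each forest gives `v` at most one parent, so the out-neighbours of `v` lie in the image of the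
-- `a` forests under `λ i → par i v`.
forests⇒orientation : (G : Graph) {a : ℕ} → ForestPartition G a → Orientation G a
forests⇒orientation G {a} (col , col-sym , acyclic) = record
  { arc       = arc
  ; arc⇒adj   = proj₁ ∘ half⁻ ∘ proj₁ ∘ ∧-true⁻
  ; adj⇒arc   = total
  ; arc-asym  = asym
  ; outdegree = λ v → begin
      # (arc v)                                          ≤⟨ #-mono (arc⊆image v) ⟩
      # (image (λ _ → true) (λ i → par i v))             ≤⟨ #-image (λ _ → true) (λ i → par i v) ⟩
      # (λ i → true ∧ is-just (par i v))                 ≤⟨ #-mono (λ _ _ → refl) ⟩
      # {a} (λ _ → true)                                 ≡⟨ #-all a ⟩
      a                                                  ∎
  }
  where
  open ≤-Reasoning
  V = Fin (n G)
  E : Fin a → V → V → Set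
  E i u v = adj G u v ≡ true × col u v ≡ i
  adj-sym : ∀ {u v} → adj G u v ≡ true → adj G v u ≡ true
  adj-sym {u} {v} = trans (Graph.sym G v u)
  E? : ∀ i u v → Dec (E i u v)
  E? i u v = (adj G u v Bool.≟ true) ×-dec (col u v ≟ i)
  E-sym : ∀ i {u v} → E i u v → E i v u
  E-sym i {u} {v} (uv , e) = adj-sym uv , trans (sym (col-sym u v uv)) e
  pm : ∀ i → ParentMap (E i) (λ v e → true≢false (proj₁ e) (irrefl G v)) (E? i) (E-sym i) (λ _ → true)
  pm i = parentMap (E i) (λ v e → true≢false (proj₁ e) (irrefl G v))
    (E? i) (E-sym i) (acyclic i) _ (λ _ → true) ≤-refl
  par : Fin a → V → Maybe V
  par i = proj₁ (pm i)
  half : V → V → Bool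
  half u v = adj G u v ∧ does (maybe-≡-dec _≟_ (par (col u v) u) (just v))
  half⁻ : ∀ {u v} → half u v ≡ true → adj G u v ≡ true × par (col u v) u ≡ just v
  half⁻ {u} {v} h with ∧-true⁻ {adj G u v} h
  ... | uv , d = uv , does-sound (maybe-≡-dec _≟_ _ _) d
  half⁺ : ∀ {u v} → adj G u v ≡ true → par (col u v) u ≡ just v → half u v ≡ true
  half⁺ uv e = ∧-true⁺ uv (dec-true (maybe-≡-dec _≟_ _ _) e)
  half-total : ∀ {u v} → adj G u v ≡ true → half u v ≡ true ⊎ half v u ≡ true
  half-total {u} {v} uv with proj₂ (pm (col u v)) u v refl refl (uv , refl)
  ... | inj₁ e = inj₁ (half⁺ uv e)
  ... | inj₂ e = inj₂ (half⁺ (adj-sym uv) (subst (λ i → par i v ≡ just u) (col-sym u v uv) e))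
  -- An edge may join two vertices that are parents of each other; the smaller one then wins.
  _≺_ : V → V → Bool
  u ≺ v = toℕ u ℕ.<ᵇ toℕ v
  ≺-asym : ∀ u v → (u ≺ v) ≡ true → (v ≺ u) ≢ true
  ≺-asym u v uv vu = ℕₚ.<-asym (ℕₚ.<ᵇ⇒< _ _ (subst T (sym uv) _)) (ℕₚ.<ᵇ⇒< (toℕ v) _ (subst T (sym vu) _))
  ≺-total : ∀ {u v} → u ≢ v → (u ≺ v) ≡ true ⊎ (v ≺ u) ≡ true
  ≺-total {u} {v} u≢v with <-cmp u v
  ... | tri< u<v _ _ = inj₁ (T⇒true (ℕₚ.<⇒<ᵇ u<v))
  ... | tri≈ _ u≡v _ = contradiction u≡v u≢v
  ... | tri> _ _ v<u = inj₂ (T⇒true (ℕₚ.<⇒<ᵇ v<u))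
  arc : V → V → Bool
  arc u v = half u v ∧ not (half v u ∧ (v ≺ u))
  total : ∀ {u v} → adj G u v ≡ true → arc u v ≡ true ⊎ arc v u ≡ true
  total {u} {v} uv with half u v | half v u | v ≺ u in vu | u ≺ v in uv′ | half-total {u} {v} uv
  ... | false | false | _     | _     | inj₁ ()
  ... | false | false | _     | _     | inj₂ ()
  ... | true  | false | _     | _     | _ = inj₁ refl
  ... | false | true  | _     | _     | _ = inj₂ refl
  ... | true  | true  | false | _     | _ = inj₁ refl
  ... | true  | true  | true  | false | _ = inj₂ refl
  ... | true  | true  | true  | true  | _ = ⊥-elim (≺-asym v u vu uv′)
  asym : ∀ {u v} → arc u v ≡ true → arc v u ≢ true
  asym {u} {v} uv vu with half⁻ (proj₁ (∧-true⁻ uv)) | ≺-total {u} {v}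
  ... | adj-uv , _ | compare with half u v | half v u | v ≺ u | u ≺ v
  asym {u} {v} () vu | adj-uv , _ | compare | true | true | true | _
  asym {u} {v} uv () | adj-uv , _ | compare | true | true | false | true
  asym {u} {v} uv vu | adj-uv , _ | compare | true | true | false | false
    with compare (λ { refl → true≢false adj-uv (irrefl G u) })
  ... | inj₁ ()
  ... | inj₂ ()
  arc⊆image : ∀ v p → arc v p ≡ true → image (λ _ → true) (λ i → par i v) p ≡ true
  arc⊆image v p vp = image⁺ (λ _ → true) (λ i → par i v) (col v p) refl (proj₂ (half⁻ (proj₁ (∧-true⁻ vp))))

-- The strategy

size : ∀ {n} → (Fin n → Fin n → Bool) → ℕ
size P = ∑ (λ x → # (P x))

size-strict : ∀ {n} {P Q : Fin n → Fin n → Bool} x y →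
              (∀ u v → P u v ≡ true → Q u v ≡ true) → P x y ≢ true → Q x y ≡ true → size P < size Q
size-strict x y P⊆Q ¬p q = ∑-strict x (λ u → #-mono (P⊆Q u)) (#-strict y (P⊆Q x) ¬p q)

is-just⁻ : ∀ {A : Set} {x : Maybe A} → is-just x ≡ true → ∃ λ a → x ≡ just a
is-just⁻ {x = just a} _ = a , refl

is-just⁺ : ∀ {A : Set} {x : Maybe A} {a} → x ≡ just a → is-just x ≡ true
is-just⁺ refl = refl

nothing≢just : ∀ {A : Set} {x : Maybe A} {a} → x ≡ nothing → x ≢ just a
nothing≢just refl ()

δ : ∀ {n} → Fin n → Fin n → ℕ
δ u v = 𝟙 (u == v)

δ-self : ∀ {n} (u : Fin n) → δ u u ≡ 1
δ-self u = cong 𝟙 (==-refl u)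

δ-other : ∀ {n} {u v : Fin n} → u ≢ v → δ u v ≡ 0
δ-other {u = u} {v} u≢v = cong 𝟙 (dec-false (u ≟ v) u≢v)

δ≤1 : ∀ {n} (u v : Fin n) → δ u v ≤ 1
δ≤1 u v with u == v
... | true  = ≤-refl
... | false = z≤n

-- For an arc x → p, the incidence (x , xp) is up and (p , px) is down; in the game they are the
-- pairs (x , p) and (p , x).
data Kind : Set where
  up down : Kind

same : Kind → Kind → Bool
same up   up   = true
same down down = true
same _    _    = false

same-refl : ∀ κ → same κ κ ≡ true
same-refl up   = refl
same-refl down = refl

same-sound : ∀ {κ κ′} → same κ κ′ ≡ true → κ ≡ κ′
same-sound {up}   {up}   _ = refl
same-sound {down} {down} _ = refl

-- The number of forests is a = `suc b`. The hypothesis `enough` expresses k ≥ (3Δ + 15a)/2 - 1,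
-- rounded down, without division or truncated subtraction; it is applied with s one more than the
-- number of forbidden colours.
module Strategy (G : Graph) (b k : ℕ) (O : Orientation G (suc b))
  (enough : ∀ s → 2 * s + 2 ≤ 3 * maxDegree G + 15 * suc b → s ≤ k) where

  open Orientation O
  open Game G k

  adj-sym : ∀ {u v} → adj G u v ≡ true → adj G v u ≡ true
  adj-sym {u} {v} = trans (Graph.sym G v u)

  Inc-irrefl : ∀ {v} → ¬ Inc v v
  Inc-irrefl {v} vv = true≢false vv (irrefl G v)

  arc⇒adj′ : ∀ {u v} → arc u v ≡ true → adj G v u ≡ true
  arc⇒adj′ uv = adj-sym (arc⇒adj uv)

  -- Incidences of arcs and partial colourings

  src dst : Kind → V → V → V
  src up   x p = x
  src down x p = p
  dst up   x p = p
  dst down x p = x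

  -- By `arc-asym` no ordered pair is an up incidence of one arc and a down incidence of another.
  src-dst-injective : ∀ {κ κ′ x p y q} → arc x p ≡ true → arc y q ≡ true →
                      src κ x p ≡ src κ′ y q → dst κ x p ≡ dst κ′ y q →
                      κ ≡ κ′ × x ≡ y × p ≡ q
  src-dst-injective {up}   {up}   _  _  refl refl = refl , refl , refl
  src-dst-injective {down} {down} _  _  refl refl = refl , refl , refl
  src-dst-injective {up}   {down} xp yq refl refl = ⊥-elim (arc-asym xp yq)
  src-dst-injective {down} {up}   xp yq refl refl = ⊥-elim (arc-asym xp yq)

  at : Coloring → Kind → V → V → Maybe (Fin k)
  at c κ x p = c (src κ x p) (dst κ x p)

  paint : Coloring → Kind → V → V → Fin k → Coloring
  paint c κ x p = update c (src κ x p) (dst κ x p)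

  coloured : Coloring → Kind → V → V → Bool
  coloured c κ x p = is-just (at c κ x p)

  module _ (c : Coloring) (u v : V) (α : Fin k) where

    update-self : update c u v α u v ≡ just α
    update-self with u ≟ u | v ≟ v
    ... | yes _  | yes _  = refl
    ... | no u≢u | _      = contradiction refl u≢u
    ... | yes _  | no v≢v = contradiction refl v≢v

    update-nothing : ∀ {x y} → update c u v α x y ≡ nothing → c x y ≡ nothing
    update-nothing {x} {y} e with u ≟ x | v ≟ y
    ... | no _  | _    = e
    ... | yes _ | no _ = e
    update-nothing () | yes _ | yes _

    update-just : ∀ {x y β} → update c u v α x y ≡ just β →
                  c x y ≡ just β ⊎ (u ≡ x × v ≡ y × α ≡ β)
    update-just {x} {y} e with u ≟ x | v ≟ y
    ... | no _    | _       = inj₁ e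
    ... | yes _   | no _    = inj₁ e
    ... | yes u≡x | yes v≡y = inj₂ (u≡x , v≡y , just-injective e)

    update-is-just : ∀ {x y} → is-just (c x y) ≡ true → is-just (update c u v α x y) ≡ true
    update-is-just {x} {y} h with u ≟ x | v ≟ y
    ... | no _  | _     = h
    ... | yes _ | no _  = h
    ... | yes _ | yes _ = refl

  module _ {c : Coloring} {κ : Kind} {x p : V} {α : Fin k} (xp : arc x p ≡ true) where

    at-paint-just : ∀ {κ′ y q β} → arc y q ≡ true → at (paint c κ x p α) κ′ y q ≡ just β →
                    at c κ′ y q ≡ just β ⊎ ((κ ≡ κ′ × x ≡ y × p ≡ q) × α ≡ β)
    at-paint-just yq e with update-just c (src κ x p) (dst κ x p) α e
    ... | inj₁ old                = inj₁ old
    ... | inj₂ (s≡ , d≡ , refl) = inj₂ (src-dst-injective xp yq s≡ d≡ , refl)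

  -- Marks, palettes and the invariants

  Marks : Set
  Marks = Kind → V → V → Bool

  mark : Marks → Kind → V → V → Marks
  mark m κ x p κ′ y q = m κ′ y q ∨ (same κ κ′ ∧ ((x == y) ∧ (p == q)))

  module _ (m : Marks) (κ : Kind) (x p : V) where

    mark-self : mark m κ x p κ x p ≡ true
    mark-self rewrite same-refl κ | ==-refl x | ==-refl p = ∨-zeroʳ (m κ x p)

    mark-mono : ∀ {κ′ y q} → m κ′ y q ≡ true → mark m κ x p κ′ y q ≡ true
    mark-mono h rewrite h = refl

    mark⁻ : ∀ {κ′ y q} → mark m κ x p κ′ y q ≡ true →
            m κ′ y q ≡ true ⊎ (κ ≡ κ′ × x ≡ y × p ≡ q)
    mark⁻ {κ′} {y} {q} h with ∨-true⁻ {m κ′ y q} h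
    ... | inj₁ old = inj₁ old
    ... | inj₂ new with ∧-true⁻ {same κ κ′} new
    ...   | e , e′ with ∧-true⁻ {x == y} e′
    ...     | e₁ , e₂ = inj₂ (same-sound e , ==-sound e₁ , ==-sound e₂)

  -- load grows by at most one per visit to v, and credit counts the steps already spent there; credit
  -- of kind up counts all of them, because the down incidences come first.
  below : Marks → Kind → V → ℕ
  below m κ v = # (λ x → arc x v ∧ m κ x v)

  load : Marks → V → ℕ
  load m v = below m up v + below m down v

  marked : Marks → Kind → V → ℕ
  marked m κ v = # (λ p → arc v p ∧ m κ v p)

  painted : Coloring → Kind → V → ℕ
  painted c κ v = # (λ p → arc v p ∧ coloured c κ v p)

  effort : Coloring → Marks → Kind → V → ℕ
  effort c m κ v = marked m κ v + painted c κ v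

  credit : Coloring → Marks → Kind → V → ℕ
  credit c m down v = effort c m down v
  credit c m up   v = effort c m down v + effort c m up v

  palette : Coloring → V → Fin k → Bool
  palette c v = image (λ s → arc s v) (λ s → at c up s v)

  received : Coloring → V → ℕ
  received c v = # (λ s → arc s v ∧ coloured c up s v)

  -- M = 6a − 1 with a = b + 1; at most M − 1 palette colours cannot be reused (see #near).
  M : ℕ
  M = 5 + 6 * b

  -- e and j measure by how much the invariants may fail at a vertex: by one at the vertex above
  -- Bob's last move or reached by the climb, and by zero elsewhere.
  record Balanced (c : Coloring) (m : Marks) (e : V → ℕ) : Set where
    field
      coloured⇒marked : ∀ {κ x p α} → arc x p ≡ true → at c κ x p ≡ just α → m κ x p ≡ true
      load≤           : ∀ {κ x p} → arc x p ≡ true → at c κ x p ≡ nothing →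
                        load m x ≤ credit c m κ x + e x
  open Balanced

  -- A new palette colour adds two on the left and one on the right, a debt of one that a later
  -- reuse at another child repays. Once every child has its up incidence coloured no repayment is
  -- possible, so `unfilled` no longer applies and `always` keeps the bound with the debt included.
  record Frugal (c : Coloring) (j : V → ℕ) : Set where
    field
      always    : ∀ v → 2 * # (palette c v) ≤ suc (M + received c v)
      unfilled  : ∀ {s v} → arc s v ≡ true → at c up s v ≡ nothing →
                  2 * # (palette c v) ≤ M + received c v + j v
  open Frugal

  -- The instance of properness that justifies reuse: a palette colour of `p` occurs on no incidence
  -- (p , pt).
  Proper : Coloring → Set
  Proper c = ∀ {s p t α} → Inc s p → Inc p t → c s p ≡ just α → c p t ≢ just α

  record Inv (c : Coloring) (m : Marks) (e j : V → ℕ) : Set where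
    constructor inv
    field
      balanced : Balanced c m e
      frugal   : Frugal c j
      proper   : Proper c
  open Inv

  none : V → ℕ
  none _ = 0

  none≤1 : ∀ v → none v ≤ 1
  none≤1 _ = z≤n

  Open : Coloring → Kind → V → Set
  Open c κ v = ∃ λ p → arc v p ≡ true × at c κ v p ≡ nothing

  Open? : ∀ c κ v → Dec (Open c κ v)
  Open? c κ v = any? λ p → (arc v p Bool.≟ true) ×-dec maybe-≡-dec _≟_ (at c κ v p) nothing

  First : Coloring → Kind → V → Set
  First c κ x = κ ≡ up → ¬ Open c down x

  -- Effect of marking and colouring on the load

  credit-mono : ∀ {c c′ m m′} v → (∀ κ → effort c m κ v ≤ effort c′ m′ κ v) →
                ∀ κ → credit c m κ v ≤ credit c′ m′ κ v
  credit-mono v h down = h down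
  credit-mono v h up   = +-mono-≤ (h down) (h up)

  -- A step on a down incidence of `x` raises both credits of `x`. A step on an up incidence raises
  -- only the credit of kind `up`, but by `First` no down incidence of `x` is then open, so the
  -- other credit is not asked for.
  credit-gain : ∀ {c c′ m m′} κ x → (∀ κ′ v → effort c m κ′ v ≤ effort c′ m′ κ′ v) →
                effort c m κ x < effort c′ m′ κ x → First c κ x →
                ∀ κ′ v → Open c κ′ v → credit c m κ′ v + δ x v ≤ credit c′ m′ κ′ v
  credit-gain {c} {c′} {m} {m′} κ x mono gain first κ′ v o with x ≟ v
  ... | no _     = ≤-trans (≤-reflexive (+-identityʳ _)) (credit-mono v (λ κ → mono κ v) κ′)
  ... | yes refl = ≤-trans (≤-reflexive (+-comm _ 1)) (strict κ κ′ gain first o)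
    where
    strict : ∀ κ κ′ → effort c m κ x < effort c′ m′ κ x → First c κ x → Open c κ′ x →
             credit c m κ′ x < credit c′ m′ κ′ x
    strict down down gain _ _ = gain
    strict down up   gain _ _ = +-mono-<-≤ gain (mono up x)
    strict up   up   gain _ _ = +-mono-≤-< (mono down x) gain
    strict up   down _ first o = contradiction o (first refl)

  effort-mono : ∀ c c′ m m′ → (∀ {κ x p} → m κ x p ≡ true → m′ κ x p ≡ true) →
                (∀ {κ x p} → coloured c κ x p ≡ true → coloured c′ κ x p ≡ true) →
                ∀ κ v → effort c m κ v ≤ effort c′ m′ κ v
  effort-mono c c′ m m′ m⊆ c⊆ κ v =
    +-mono-≤ (#-mono (λ p h → let vp , h′ = ∧-true⁻ h in ∧-true⁺ vp (m⊆ {κ} {v} {p} h′)))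
             (#-mono (λ p h → let vp , h′ = ∧-true⁻ h in ∧-true⁺ vp (c⊆ {κ} {v} {p} h′)))

  Balanced-weaken : ∀ {c m e e′} → (∀ v → e v ≤ e′ v) → Balanced c m e → Balanced c m e′
  Balanced-weaken e≤e′ B .coloured⇒marked = coloured⇒marked B
  Balanced-weaken e≤e′ B .load≤ xp o      = ≤-trans (load≤ B xp o) (+-monoʳ-≤ _ (e≤e′ _))

  Balanced-closed : ∀ {c m v} → (∀ κ → ¬ Open c κ v) → Balanced c m (δ v) → Balanced c m none
  Balanced-closed closed B .coloured⇒marked = coloured⇒marked B
  Balanced-closed {v = v} closed B .load≤ {κ} {x} {p} xp o with v ≟ x | load≤ B xp o
  ... | yes refl | _ = contradiction (p , xp , o) (closed κ)
  ... | no _     | h = h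

  module _ (m : Marks) (κ : Kind) (x p : V) where

    below-mark-other : ∀ κ′ v → ¬ (κ ≡ κ′ × p ≡ v) → below (mark m κ x p) κ′ v ≤ below m κ′ v
    below-mark-other κ′ v ne = #-mono λ y h → case mark⁻ m κ x p {κ′} {y} {v} (proj₂ (∧-true⁻ {arc y v} h)) of λ where
      (inj₁ old)              → ∧-true⁺ (proj₁ (∧-true⁻ h)) old
      (inj₂ (refl , _ , p≡v)) → contradiction (refl , p≡v) ne

    below-mark : ∀ κ′ v → below (mark m κ x p) κ′ v ≤ suc (below m κ′ v)
    below-mark κ′ v = #-insert x λ y h → case mark⁻ m κ x p {κ′} {y} {v} (proj₂ (∧-true⁻ {arc y v} h)) of λ where
      (inj₁ old)           → inj₁ (∧-true⁺ (proj₁ (∧-true⁻ h)) old)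
      (inj₂ (_ , x≡y , _)) → inj₂ x≡y

  -- The incidence belongs to an arc into `p`, so only the load of `p` can change, and there only
  -- the summand of kind `κ`.
  load-mark : ∀ m κ x p v → load (mark m κ x p) v ≤ load m v + δ p v
  load-mark m κ x p v = split (p ≟ v)
    where
    bump : ∀ κ → load (mark m κ x p) p ≤ suc (load m p)
    bump up   = +-mono-≤ (below-mark m up x p up p) (below-mark-other m up x p down p λ ())
    bump down = ≤-trans (+-mono-≤ (below-mark-other m down x p up p λ ()) (below-mark m down x p down p))
                        (≤-reflexive (+-suc _ _))
    split : Dec (p ≡ v) → load (mark m κ x p) v ≤ load m v + δ p v
    split (no p≢v)   = ≤-trans (+-mono-≤ (below-mark-other m κ x p up v (p≢v ∘ proj₂))
                                         (below-mark-other m κ x p down v (p≢v ∘ proj₂)))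
                               (m≤m+n _ (δ p v))
    split (yes refl) = ≤-trans (bump κ) (≤-reflexive (trans (+-comm 1 _) (cong (load m p +_) (sym (δ-self p)))))

  effort-mark : ∀ c m κ x p κ′ v → effort c m κ′ v ≤ effort c (mark m κ x p) κ′ v
  effort-mark c m κ x p = effort-mono c c m (mark m κ x p) (mark-mono m κ x p) id

  effort-paint : ∀ c m κ x p α κ′ v → effort c m κ′ v ≤ effort (paint c κ x p α) m κ′ v
  effort-paint c m κ x p α = effort-mono c (paint c κ x p α) m m id (update-is-just c (src κ x p) (dst κ x p) α)

  effort-mark-gain : ∀ c m κ x p → arc x p ≡ true → m κ x p ≢ true →
                     effort c m κ x < effort c (mark m κ x p) κ x
  effort-mark-gain c m κ x p xp ¬mk = +-monoˡ-< (painted c κ x)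
    (#-strict p (λ q h → let xq , h′ = ∧-true⁻ h in ∧-true⁺ xq (mark-mono m κ x p h′))
      (¬mk ∘ proj₂ ∘ ∧-true⁻) (∧-true⁺ xp (mark-self m κ x p)))

  effort-paint-gain : ∀ c m κ x p α → arc x p ≡ true → at c κ x p ≡ nothing →
                      effort c m κ x < effort (paint c κ x p α) m κ x
  effort-paint-gain c m κ x p α xp free = +-monoʳ-< (marked m κ x)
    (#-strict p (λ q h → let xq , h′ = ∧-true⁻ h in
                           ∧-true⁺ xq (update-is-just c (src κ x p) (dst κ x p) α h′))
      (λ h → nothing≢just free (proj₂ (is-just⁻ (proj₂ (∧-true⁻ h)))))
      (∧-true⁺ xp (is-just⁺ (update-self c (src κ x p) (dst κ x p) α))))

  -- Used for marks made outside a climb, on Bob's incidence or on a reused colour's: no credit is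
  -- claimed for them, so the added load is booked as excess at `p`.
  Balanced-touch : ∀ {c m e} κ x p → Balanced c m e → Balanced c (mark m κ x p) (λ v → e v + δ p v)
  Balanced-touch {m = m} κ x p B .coloured⇒marked yq e = mark-mono m κ x p (coloured⇒marked B yq e)
  Balanced-touch {c} {m} {e} κ x p B .load≤ {κ′} {y} yq o = begin
    load (mark m κ x p) y                           ≤⟨ load-mark m κ x p y ⟩
    load m y + δ p y                                ≤⟨ +-monoˡ-≤ (δ p y) (load≤ B yq o) ⟩
    credit c m κ′ y + e y + δ p y                   ≡⟨ +-assoc (credit c m κ′ y) _ _ ⟩
    credit c m κ′ y + (e y + δ p y)                 ≤⟨ +-monoˡ-≤ (e y + δ p y) (credit-mono y (λ κ″ → effort-mark c m κ x p κ″ y) κ′) ⟩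
    credit c (mark m κ x p) κ′ y + (e y + δ p y)    ∎
    where open ≤-Reasoning

  -- One step of the climb: the new mark raises the credit of `x`, which absorbs the excess there,
  -- and raises the load of `p`, where the excess reappears.
  Balanced-mark : ∀ {c m} κ x p → arc x p ≡ true → m κ x p ≢ true → First c κ x →
                  Balanced c m (δ x) → Balanced c (mark m κ x p) (δ p)
  Balanced-mark {m = m} κ x p xp ¬mk first B .coloured⇒marked yq e = mark-mono m κ x p (coloured⇒marked B yq e)
  Balanced-mark {c} {m} κ x p xp ¬mk first B .load≤ {κ′} {y} yq o = begin
    load (mark m κ x p) y                    ≤⟨ load-mark m κ x p y ⟩
    load m y + δ p y                         ≤⟨ +-monoˡ-≤ (δ p y) (load≤ B yq o) ⟩
    credit c m κ′ y + δ x y + δ p y          ≤⟨ +-monoˡ-≤ (δ p y)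
        (credit-gain κ x (effort-mark c m κ x p) (effort-mark-gain c m κ x p xp ¬mk) first κ′ y (_ , yq , o)) ⟩
    credit c (mark m κ x p) κ′ y + δ p y     ∎
    where open ≤-Reasoning

  module _ {c : Coloring} {m : Marks} {κ : Kind} {x p : V} (α : Fin k) (xp : arc x p ≡ true) (mk : m κ x p ≡ true) where

    paint-marked : ∀ {e} → Balanced c m e → ∀ {κ′ y q β} → arc y q ≡ true →
                   at (paint c κ x p α) κ′ y q ≡ just β → m κ′ y q ≡ true
    paint-marked B yq e with at-paint-just {c} {κ} xp yq e
    ... | inj₁ old                        = coloured⇒marked B yq old
    ... | inj₂ ((refl , refl , refl) , _) = mk

    Balanced-paint : ∀ {e} → Balanced c m e → Balanced (paint c κ x p α) m e
    Balanced-paint B .coloured⇒marked = paint-marked B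
    Balanced-paint {e} B .load≤ {κ′} {y} yq o =
      ≤-trans (load≤ B yq (update-nothing c (src κ x p) (dst κ x p) α o))
              (+-monoˡ-≤ (e y) (credit-mono y (λ κ″ → effort-paint c m κ x p α κ″ y) κ′))

    -- The end of a climb: colouring a marked incidence raises the credit of `x` and adds no load
    -- anywhere, so the excess disappears.
    Balanced-paint-gain : at c κ x p ≡ nothing → First c κ x →
                          Balanced c m (δ x) → Balanced (paint c κ x p α) m none
    Balanced-paint-gain free first B .coloured⇒marked = paint-marked B
    Balanced-paint-gain free first B .load≤ {κ′} {y} yq o =
      ≤-trans (load≤ B yq o′)
        (≤-trans (credit-gain κ x (effort-paint c m κ x p α) (effort-paint-gain c m κ x p α xp free)
                              first κ′ y (_ , yq , o′))
                 (≤-reflexive (sym (+-identityʳ _))))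
      where
      o′ : at c κ′ y _ ≡ nothing
      o′ = update-nothing c (src κ x p) (dst κ x p) α o

  -- Effect of colouring on the palettes

  #palette≤received : ∀ c v → # (palette c v) ≤ received c v
  #palette≤received c v = #-image (λ s → arc s v) (λ s → at c up s v)

  received-paint : ∀ c κ x p α v → received c v ≤ received (paint c κ x p α) v
  received-paint c κ x p α v = #-mono λ s h →
    ∧-true⁺ (proj₁ (∧-true⁻ {arc s v} h))
            (update-is-just c (src κ x p) (dst κ x p) α (proj₂ (∧-true⁻ {arc s v} h)))

  received-gain : ∀ c x p α → arc x p ≡ true → at c up x p ≡ nothing →
                  received c p < received (paint c up x p α) p
  received-gain c x p α xp free = #-strict x
    (λ s h → ∧-true⁺ (proj₁ (∧-true⁻ {arc s p} h)) (update-is-just c x p α (proj₂ (∧-true⁻ {arc s p} h))))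
    (λ h → nothing≢just free (proj₂ (is-just⁻ (proj₂ (∧-true⁻ h)))))
    (∧-true⁺ xp (is-just⁺ (update-self c x p α)))

  palette-paint : ∀ {c κ x p α} → arc x p ≡ true → ∀ v β → palette (paint c κ x p α) v β ≡ true →
                  palette c v β ≡ true ⊎ ((κ ≡ up × p ≡ v) × α ≡ β)
  palette-paint {c} {κ} {x} {p} {α} xp v β h
    with image⁻ (λ s → arc s v) (λ s → at (paint c κ x p α) up s v) {β} h
  ... | s , sv , e with at-paint-just {c} {κ} xp {up} {s} {v} sv e
  ...   | inj₁ old                           = inj₁ (image⁺ (λ s → arc s v) (λ s → at c up s v) s sv old)
  ...   | inj₂ ((κ≡up , _ , p≡v) , α≡β) = inj₂ ((κ≡up , p≡v) , α≡β)

  palette-paint-other : ∀ {c κ x p α} → arc x p ≡ true → ∀ v → ¬ (κ ≡ up × p ≡ v) →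
                        # (palette (paint c κ x p α) v) ≤ # (palette c v)
  palette-paint-other {c} {κ} xp v ne = #-mono λ β h → case palette-paint {c} {κ} xp v β h of λ where
    (inj₁ old)     → old
    (inj₂ (e , _)) → contradiction e ne

  palette-paint-up : ∀ {c x p α} → arc x p ≡ true →
                     # (palette (paint c up x p α) p) ≤ suc (# (palette c p))
  palette-paint-up {c} {α = α} xp = #-insert α λ β h → case palette-paint {c} {up} xp _ β h of λ where
    (inj₁ old)     → inj₁ old
    (inj₂ (_ , e)) → inj₂ e

  palette-reuse : ∀ {c x p α} → arc x p ≡ true → palette c p α ≡ true →
                  # (palette (paint c up x p α) p) ≤ # (palette c p)
  palette-reuse {c} {α = α} xp α∈ = #-mono λ β h → case palette-paint {c} {up} xp _ β h of λ where
    (inj₁ old)        → old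
    (inj₂ (_ , refl)) → α∈

  Frugal-paint-down : ∀ {c j x p α} → arc x p ≡ true → Frugal c j → Frugal (paint c down x p α) j
  Frugal-paint-down {c} {j} {x} {p} {α} xp F .always v = begin
    2 * # (palette (paint c down x p α) v)  ≤⟨ *-monoʳ-≤ 2 (palette-paint-other {c} {down} xp v λ ()) ⟩
    2 * # (palette c v)                     ≤⟨ always F v ⟩
    suc (M + received c v)                  ≤⟨ s≤s (+-monoʳ-≤ M (received-paint c down x p α v)) ⟩
    suc (M + received (paint c down x p α) v) ∎
    where open ≤-Reasoning
  Frugal-paint-down {c} {j} {x} {p} {α} xp F .unfilled {s} {v} sv free = begin
    2 * # (palette (paint c down x p α) v)  ≤⟨ *-monoʳ-≤ 2 (palette-paint-other {c} {down} xp v λ ()) ⟩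
    2 * # (palette c v)                     ≤⟨ unfilled F sv (update-nothing c p x α free) ⟩
    M + received c v + j v                  ≤⟨ +-monoˡ-≤ (j v) (+-monoʳ-≤ M (received-paint c down x p α v)) ⟩
    M + received (paint c down x p α) v + j v ∎
    where open ≤-Reasoning

  -- Only the palette of `p` can grow. Its new bound with debt `i` serves both fields: `i ≤ 1` gives
  -- `always` and `i ≤ j′ p` gives `unfilled`.
  Frugal-paint-up : ∀ {c j j′ x p α i} → arc x p ≡ true → (∀ v → p ≢ v → j v ≤ j′ v) → i ≤ 1 → i ≤ j′ p →
                    2 * # (palette (paint c up x p α) p) ≤ M + received (paint c up x p α) p + i →
                    Frugal c j → Frugal (paint c up x p α) j′
  Frugal-paint-up {c} {j} {j′} {x} {p} {α} {i} xp j≤j′ i≤1 i≤j′ at-p F = record { always = always′ ; unfilled = unfilled′ }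
    where
    open ≤-Reasoning
    always′ : ∀ v → 2 * # (palette (paint c up x p α) v) ≤ suc (M + received (paint c up x p α) v)
    always′ v = split (p ≟ v)
      where
      split : Dec (p ≡ v) → 2 * # (palette (paint c up x p α) v) ≤ suc (M + received (paint c up x p α) v)
      split (yes refl) = ≤-trans at-p (≤-trans (+-monoʳ-≤ _ i≤1) (≤-reflexive (+-comm _ 1)))
      split (no p≢v) = begin
        2 * # (palette (paint c up x p α) v)    ≤⟨ *-monoʳ-≤ 2 (palette-paint-other {c} {up} xp v (p≢v ∘ proj₂)) ⟩
        2 * # (palette c v)                     ≤⟨ always F v ⟩
        suc (M + received c v)                  ≤⟨ s≤s (+-monoʳ-≤ M (received-paint c up x p α v)) ⟩
        suc (M + received (paint c up x p α) v) ∎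
    unfilled′ : ∀ {s v} → arc s v ≡ true → at (paint c up x p α) up s v ≡ nothing →
                2 * # (palette (paint c up x p α) v) ≤ M + received (paint c up x p α) v + j′ v
    unfilled′ {s} {v} sv free = split (p ≟ v)
      where
      split : Dec (p ≡ v) → 2 * # (palette (paint c up x p α) v) ≤ M + received (paint c up x p α) v + j′ v
      split (yes refl) = ≤-trans at-p (+-monoʳ-≤ _ i≤j′)
      split (no p≢v) = begin
        2 * # (palette (paint c up x p α) v)    ≤⟨ *-monoʳ-≤ 2 (palette-paint-other {c} {up} xp v (p≢v ∘ proj₂)) ⟩
        2 * # (palette c v)                     ≤⟨ unfilled F sv (update-nothing c x p α free) ⟩
        M + received c v + j v                  ≤⟨ +-mono-≤ (+-monoʳ-≤ M (received-paint c up x p α v)) (j≤j′ v p≢v) ⟩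
        M + received (paint c up x p α) v + j′ v ∎

  -- A new colour costs two on the left, and the newly coloured incidence pays back one of them.
  Frugal-any : ∀ {c x p α} → arc x p ≡ true → at c up x p ≡ nothing →
               Frugal c none → Frugal (paint c up x p α) (δ p)
  Frugal-any {c} {x} {p} {α} xp free F =
    Frugal-paint-up {c} xp (λ _ _ → z≤n) ≤-refl (≤-reflexive (sym (δ-self p))) bound F
    where
    open ≤-Reasoning
    rearrange : ∀ r → 2 + (M + r + 0) ≡ M + suc r + 1
    rearrange r = begin-equality
      2 + (M + r + 0)  ≡⟨ cong (2 +_) (+-identityʳ (M + r)) ⟩
      2 + (M + r)      ≡⟨ cong suc (+-suc M r) ⟨
      suc (M + suc r)  ≡⟨ +-comm 1 _ ⟩
      M + suc r + 1    ∎
    bound : 2 * # (palette (paint c up x p α) p) ≤ M + received (paint c up x p α) p + 1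
    bound = begin
      2 * # (palette (paint c up x p α) p)  ≤⟨ *-monoʳ-≤ 2 (palette-paint-up {c} xp) ⟩
      2 * suc (# (palette c p))             ≡⟨ *-suc 2 (# (palette c p)) ⟩
      2 + 2 * # (palette c p)               ≤⟨ +-monoʳ-≤ 2 (unfilled F xp free) ⟩
      2 + (M + received c p + 0)            ≡⟨ rearrange (received c p) ⟩
      M + suc (received c p) + 1            ≤⟨ +-monoˡ-≤ 1 (+-monoʳ-≤ M (received-gain c x p α xp free)) ⟩
      M + received (paint c up x p α) p + 1 ∎

  double : ∀ n → 2 * n ≡ n + n
  double n = cong (n +_) (+-identityʳ n)

  -- With at least `M` palette colours one is reused: the palette stays and `received` grows, which
  -- repays the debt in `always`. With fewer, the new palette has at most `M` colours and at most as
  -- many as were received, and adding these two bounds suffices for any colour.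
  Frugal-reuse : ∀ {c x p α} → arc x p ≡ true → at c up x p ≡ nothing →
                 (M ≤ # (palette c p) → palette c p α ≡ true) →
                 Frugal c (δ p) → Frugal (paint c up x p α) none
  Frugal-reuse {c} {x} {p} {α} xp free reuse F =
    Frugal-paint-up {c} xp (λ v p≢v → ≤-reflexive (δ-other p≢v)) z≤n z≤n
      (≤-trans (bound (M ≤? # (palette c p))) (≤-reflexive (sym (+-identityʳ _)))) F
    where
    open ≤-Reasoning
    bound : Dec (M ≤ # (palette c p)) → 2 * # (palette (paint c up x p α) p) ≤ M + received (paint c up x p α) p
    bound (yes M≤) = begin
      2 * # (palette (paint c up x p α) p)  ≤⟨ *-monoʳ-≤ 2 (palette-reuse {c} xp (reuse M≤)) ⟩
      2 * # (palette c p)                   ≤⟨ always F p ⟩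
      suc (M + received c p)                ≡⟨ +-suc M (received c p) ⟨
      M + suc (received c p)                ≤⟨ +-monoʳ-≤ M (received-gain c x p α xp free) ⟩
      M + received (paint c up x p α) p     ∎
    bound (no M≰) = begin
      2 * # (palette (paint c up x p α) p)  ≡⟨ double (# (palette (paint c up x p α) p)) ⟩
      # (palette (paint c up x p α) p) + # (palette (paint c up x p α) p)
        ≤⟨ +-mono-≤ (≤-trans (palette-paint-up {c} xp) (≰⇒> M≰)) (#palette≤received (paint c up x p α) p) ⟩
      M + received (paint c up x p α) p     ∎

  -- A palette of K ≤ M colours satisfies 2K ≤ M + K, and K is at most `received`, so `p` carries no
  -- debt.
  Frugal-small : ∀ {c p} → # (palette c p) ≤ M → Frugal c (δ p) → Frugal c none
  Frugal-small small F .always = always F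
  Frugal-small {c} {p} small F .unfilled {s} {v} sv free with p ≟ v | unfilled F sv free
  ... | no _     | h = h
  ... | yes refl | _ = begin
    2 * # (palette c p)                ≡⟨ double (# (palette c p)) ⟩
    # (palette c p) + # (palette c p)  ≤⟨ +-mono-≤ small (#palette≤received c p) ⟩
    M + received c p                   ≡⟨ +-identityʳ _ ⟨
    M + received c p + 0               ∎
    where open ≤-Reasoning

  Frugal-full : ∀ {c p} → (∀ s → arc s p ≡ true → at c up s p ≢ nothing) → Frugal c (δ p) → Frugal c none
  Frugal-full full F .always = always F
  Frugal-full {c} {p} full F .unfilled {s} {v} sv free with p ≟ v | unfilled F sv free
  ... | no _     | h = h
  ... | yes refl | _ = contradiction free (full s sv)

  Frugal-weaken : ∀ {c} j → Frugal c none → Frugal c j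
  Frugal-weaken j F .always = always F
  Frugal-weaken j F .unfilled sv free = ≤-trans (unfilled F sv free) (+-monoʳ-≤ _ z≤n)

  Proper-update : ∀ {c u v α} → Inc u v → Legal c u v α → Proper c → Proper (update c u v α)
  Proper-update {c} {u} {v} {α} uv legal P {s} {p} {t} sp pt e e′
    with update-just c u v α e | update-just c u v α e′
  ... | inj₁ o                    | inj₁ o′                   = P sp pt o o′
  ... | inj₂ (refl , refl , refl) | inj₁ o′                   =
    legal p t pt ((λ { (refl , _) → Inc-irrefl sp }) , inj₂ (inj₂ (inj₁ refl))) o′
  ... | inj₁ o                    | inj₂ (refl , refl , refl) =
    legal s p sp ((λ { (refl , _) → Inc-irrefl sp }) , inj₂ (inj₂ (inj₂ refl))) o
  -- Both being the new incidence would force `s` and `p` to coincide, making the edge `sp` a loop.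
  ... | inj₂ (refl , refl , _)    | inj₂ (refl , _ , _)       = Inc-irrefl sp

  -- Bounds on the load

  marked≤ : ∀ m κ v → marked m κ v ≤ suc b
  marked≤ m κ v = ≤-trans (#-mono (λ p → proj₁ ∘ ∧-true⁻)) (outdegree v)

  painted≤ : ∀ c κ v → painted c κ v ≤ suc b
  painted≤ c κ v = ≤-trans (#-mono (λ p → proj₁ ∘ ∧-true⁻)) (outdegree v)

  painted-open : ∀ {c κ v} → Open c κ v → painted c κ v ≤ b
  painted-open {c} {κ} {v} (p , vp , free) = s≤s⁻¹ (≤-trans
    (#-strict p (λ q → proj₁ ∘ ∧-true⁻)
      (λ h → nothing≢just free (proj₂ (is-just⁻ (proj₂ (∧-true⁻ h))))) vp)
    (outdegree v))

  module _ {c m e} (B : Balanced c m e) (e≤1 : ∀ v → e v ≤ 1) where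

    -- At most a marks and, as one down incidence is open, at most a - 1 colourings; the excess adds
    -- one, giving 2a. `load-up` gets 4a in the same way from both kinds.
    load-down : ∀ {x} → Open c down x → load m x ≤ 2 + 2 * b
    load-down {x} o@(p , xp , free) = begin
      load m x                  ≤⟨ load≤ B xp free ⟩
      credit c m down x + e x   ≤⟨ +-mono-≤ (+-mono-≤ (marked≤ m down x) (painted-open {c} {down} o)) (e≤1 x) ⟩
      suc b + b + 1             ≡⟨ eq b ⟩
      2 + 2 * b                 ∎
      where
      open ≤-Reasoning
      eq : ∀ b → suc b + b + 1 ≡ 2 + 2 * b
      eq = solve-∀

    load-up : ∀ {x} → Open c up x → load m x ≤ 4 + 4 * b
    load-up {x} o@(p , xp , free) = begin
      load m x                  ≤⟨ load≤ B xp free ⟩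
      credit c m up x + e x     ≤⟨ +-mono-≤ (+-mono-≤ (+-mono-≤ (marked≤ m down x) (painted≤ c down x))
                                                      (+-mono-≤ (marked≤ m up x) (painted-open {c} {up} o))) (e≤1 x) ⟩
      suc b + suc b + (suc b + b) + 1 ≡⟨ eq b ⟩
      4 + 4 * b                 ∎
      where
      open ≤-Reasoning
      eq : ∀ b → suc b + suc b + (suc b + b) + 1 ≡ 4 + 4 * b
      eq = solve-∀

    load-open : ∀ κ {x} → Open c κ x → load m x ≤ 4 + 4 * b
    load-open up   o = load-up o
    load-open down o = ≤-trans (load-down o) (+-mono-≤ (m≤n+m 2 2) (*-monoˡ-≤ b (m≤n+m 2 2)))

    -- More than `M` palette colours need more than `M` marked incidences of arcs into `v`, whereas
    -- an open incidence at `v` allows only 4a.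
    crowded⇒closed : ∀ {v} → M < # (palette c v) → ∀ κ → ¬ Open c κ v
    crowded⇒closed {v} M<K κ o = <⇒≱ M<K (begin
      # (palette c v)  ≤⟨ #palette≤received c v ⟩
      received c v     ≤⟨ #-mono (λ s h → let sv , h′ = ∧-true⁻ h in
                             ∧-true⁺ sv (coloured⇒marked B {up} sv (proj₂ (is-just⁻ h′)))) ⟩
      below m up v     ≤⟨ m≤m+n _ _ ⟩
      load m v         ≤⟨ load-open κ o ⟩
      4 + 4 * b        ≤⟨ +-mono-≤ (n≤1+n 4) (*-monoˡ-≤ b (m≤n+m 4 2)) ⟩
      M                ∎)
      where open ≤-Reasoning

  #-image≤ : ∀ {N} (Q : V → Bool) (f : V → Maybe (Fin N)) → # (image Q f) ≤ # Q
  #-image≤ Q f = ≤-trans (#-image Q f) (#-mono (λ z → proj₁ ∘ ∧-true⁻))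

  -- Colours forbidden to an incidence

  infixr 6 _∪_
  opaque

    _∪_ : (P Q : Fin k → Bool) → Fin k → Bool
    (P ∪ Q) α = P α ∨ Q α

    ∪ˡ : ∀ P Q {α} → P α ≡ true → (P ∪ Q) α ≡ true
    ∪ˡ P Q e rewrite e = refl

    ∪ʳ : ∀ P Q {α} → Q α ≡ true → (P ∪ Q) α ≡ true
    ∪ʳ P Q {α} e rewrite e = ∨-zeroʳ (P α)

    #-∪≤ : ∀ P Q {i j} → # P ≤ i → # Q ≤ j → # (P ∪ Q) ≤ i + j
    #-∪≤ P Q P≤ Q≤ = ≤-trans (#-∪ (λ α → ∨-true⁻)) (+-mono-≤ P≤ Q≤)

  fromChildren : Coloring → Kind → V → Fin k → Bool
  fromChildren c κ x = image (λ s → arc s x) (λ s → at c κ s x)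

  fromParents : Coloring → Kind → V → Fin k → Bool
  fromParents c κ x = image (λ t → arc x t) (λ t → at c κ x t)

  besides : V → V → V → Bool
  besides x p t = arc x t ∧ not (p == t)

  fromOthers : Coloring → Kind → V → V → Fin k → Bool
  fromOthers c κ x p = image (besides x p) (λ t → at c κ x t)

  around : Coloring → V → Fin k → Bool
  around c p = image (λ t → adj G p t) (λ t → c p t)

  aroundBut : Coloring → V → V → Fin k → Bool
  aroundBut c p x = image (λ t → adj G p t ∧ not (x == t)) (λ t → c p t)

  avoid⁻ : ∀ {Q : V → Bool} {f : V → Maybe (Fin k)} {α} → image Q f α ≢ true →
           ∀ z → Q z ≡ true → f z ≢ just α
  avoid⁻ {Q} {f} ∉ z q e = ∉ (image⁺ Q f z q e)

  but⁺ : ∀ {x t : V} {h} → h ≡ true → x ≢ t → h ∧ not (x == t) ≡ true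
  but⁺ {x = x} {t} h x≢t = ∧-true⁺ h (cong not (dec-false (x ≟ t) x≢t))

  but-strict : ∀ {P : V → Bool} {x} → P x ≡ true → # (λ t → P t ∧ not (x == t)) < # P
  but-strict {P} {x} Px = #-strict x (λ t → proj₁ ∘ ∧-true⁻)
    (λ h → case trans (sym (proj₂ (∧-true⁻ {P x} h))) (cong not (==-refl x)) of λ ()) Px

  -- The colours that (x , xp) meets at `x`. Those on incidences (p , pt) are treated separately,
  -- since `Proper` already excludes them for palette colours.
  near : Coloring → V → V → Fin k → Bool
  near c x p = fromOthers c up x p ∪ fromOthers c down x p ∪ fromChildren c up x ∪ fromChildren c down x

  -- All colours that (p , px) meets: leaving `p`, leaving `x` towards a parent or a child, and
  -- entering `p` from a parent or a child.
  far : Coloring → V → V → Fin k → Bool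
  far c x p = aroundBut c p x ∪ fromParents c up x ∪ fromChildren c down x ∪ fromParents c down p ∪ palette c p

  LegalAt : Coloring → Kind → V → V → Fin k → Set
  LegalAt c κ x p α = Legal c (src κ x p) (dst κ x p) α

  #fromChildren : ∀ {c m e} → Balanced c m e → ∀ κ x → # (fromChildren c κ x) ≤ below m κ x
  #fromChildren {c} B κ x = ≤-trans (#-image (λ s → arc s x) (λ s → at c κ s x))
    (#-mono (λ s h → let sx , h′ = ∧-true⁻ h in
      ∧-true⁺ sx (coloured⇒marked B {κ} sx (proj₂ (is-just⁻ h′)))))

  #fromOthers : ∀ c κ x p → arc x p ≡ true → # (fromOthers c κ x p) ≤ b
  #fromOthers c κ x p xp = ≤-trans (#-image≤ _ _) (s≤s⁻¹ (≤-trans (but-strict xp) (outdegree x)))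

  -- The other parents of `x` forbid at most 2(a - 1) colours and the children at most 4a by
  -- `load-up`: together M - 1.
  #near : ∀ {c m e x p} → Balanced c m e → (∀ v → e v ≤ 1) → arc x p ≡ true → at c up x p ≡ nothing →
          # (near c x p) < M
  #near {c} {m} {e} {x} {p} B e≤1 xp free = s≤s (begin
    # (near c x p)        ≤⟨ #-∪≤ _ _ (#fromOthers c up x p xp) (#-∪≤ _ _ (#fromOthers c down x p xp)
                               (#-∪≤ _ _ (#fromChildren B up x) (#fromChildren B down x))) ⟩
    b + (b + load m x)    ≤⟨ +-monoʳ-≤ b (+-monoʳ-≤ b (load-up B e≤1 (p , xp , free))) ⟩
    b + (b + (4 + 4 * b)) ≡⟨ eq b ⟩
    4 + 6 * b             ∎)
    where
    open ≤-Reasoning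
    eq : ∀ b → b + (b + (4 + 4 * b)) ≡ 4 + 6 * b
    eq = solve-∀

  up-legal : ∀ {c x p α} → arc x p ≡ true → near c x p α ≢ true → (∀ t → Inc p t → c p t ≢ just α) →
             LegalAt c up x p α
  up-legal {c} {x} {p} {α} xp ∉ ∉p s t st (ne , cases) = go cases
    where
    ∉₁ : fromOthers c up x p α ≢ true
    ∉₁ = ∉ ∘ ∪ˡ _ _
    ∉₂ : fromOthers c down x p α ≢ true
    ∉₂ = ∉ ∘ ∪ʳ (fromOthers c up x p) _ ∘ ∪ˡ _ _
    ∉₃ : fromChildren c up x α ≢ true
    ∉₃ = ∉ ∘ ∪ʳ (fromOthers c up x p) _ ∘ ∪ʳ (fromOthers c down x p) _ ∘ ∪ˡ _ _
    ∉₄ : fromChildren c down x α ≢ true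
    ∉₄ = ∉ ∘ ∪ʳ (fromOthers c up x p) _ ∘ ∪ʳ (fromOthers c down x p) _ ∘ ∪ʳ (fromChildren c up x) _
    go : x ≡ s ⊎ (x ≡ t × p ≡ s) ⊎ p ≡ s ⊎ x ≡ t → c s t ≢ just α
    go (inj₁ refl) with adj⇒arc st
    ... | inj₁ xt = avoid⁻ ∉₁ t (but⁺ xt (λ p≡t → ne (refl , p≡t)))
    ... | inj₂ tx = avoid⁻ ∉₄ t tx
    go (inj₂ (inj₁ (refl , refl))) = ∉p x st
    go (inj₂ (inj₂ (inj₁ refl)))   = ∉p t st
    go (inj₂ (inj₂ (inj₂ refl))) with adj⇒arc st | p ≟ s
    ... | inj₁ sx | _        = avoid⁻ ∉₃ s sx
    ... | inj₂ xs | yes refl = ∉p x st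
    ... | inj₂ xs | no p≢s   = avoid⁻ ∉₂ s (but⁺ xs p≢s)

  down-legal : ∀ {c x p α} → arc x p ≡ true → far c x p α ≢ true → LegalAt c down x p α
  down-legal {c} {x} {p} {α} xp ∉ s t st (ne , cases) = go cases
    where
    ∉₁ : aroundBut c p x α ≢ true
    ∉₁ = ∉ ∘ ∪ˡ _ _
    ∉₂ : fromParents c up x α ≢ true
    ∉₂ = ∉ ∘ ∪ʳ (aroundBut c p x) _ ∘ ∪ˡ _ _
    ∉₃ : fromChildren c down x α ≢ true
    ∉₃ = ∉ ∘ ∪ʳ (aroundBut c p x) _ ∘ ∪ʳ (fromParents c up x) _ ∘ ∪ˡ _ _
    ∉₄ : fromParents c down p α ≢ true
    ∉₄ = ∉ ∘ ∪ʳ (aroundBut c p x) _ ∘ ∪ʳ (fromParents c up x) _ ∘ ∪ʳ (fromChildren c down x) _ ∘ ∪ˡ _ _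
    ∉₅ : palette c p α ≢ true
    ∉₅ = ∉ ∘ ∪ʳ (aroundBut c p x) _ ∘ ∪ʳ (fromParents c up x) _ ∘ ∪ʳ (fromChildren c down x) _ ∘ ∪ʳ (fromParents c down p) _
    go : p ≡ s ⊎ (p ≡ t × x ≡ s) ⊎ x ≡ s ⊎ p ≡ t → c s t ≢ just α
    go (inj₁ refl) = avoid⁻ ∉₁ t (but⁺ st (λ x≡t → ne (refl , x≡t)))
    go (inj₂ (inj₁ (refl , refl))) = avoid⁻ ∉₂ p xp
    go (inj₂ (inj₂ (inj₁ refl))) with adj⇒arc st
    ... | inj₁ xt = avoid⁻ ∉₂ t xt
    ... | inj₂ tx = avoid⁻ ∉₃ t tx
    go (inj₂ (inj₂ (inj₂ refl))) with adj⇒arc st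
    ... | inj₁ sp = avoid⁻ ∉₅ s sp
    ... | inj₂ ps = avoid⁻ ∉₄ s ps

  degree≤Δ : ∀ v → # (λ t → adj G v t) ≤ maxDegree G
  degree≤Δ v = subst (_≤ maxDegree G) (degree≡# G v) (degree≤maxDegree G v)

  available : ∀ {P : Fin k → Bool} → # P < k → ∃ λ α → P α ≢ true
  available P<k with choose {Q = λ _ → true} (≤-trans P<k (≤-reflexive (sym (#-all k))))
  ... | α , _ , ∉ = α , ∉

  -- Here d is the degree of `p`, D and D′ bound its parents and children, and K is its palette
  -- size. Doubling turns A into less than 2d and K into about D′; with D + D′ ≤ d this makes 3d,
  -- and the D left over is at most a.
  far-arithmetic : ∀ {F A D D′ K d Δ} → F ≤ A + (suc b + (2 + 2 * b + (D + K))) → A < d →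
                   2 * K ≤ suc (M + D′) → D + D′ ≤ d → D ≤ suc b → d ≤ Δ →
                   2 * suc F + 2 ≤ 3 * Δ + 15 * suc b
  far-arithmetic {F} {A} {D} {D′} {K} {d} {Δ} F≤ A<d K≤ D+D′≤ D≤ d≤ = begin
    2 * suc F + 2
      ≤⟨ +-monoˡ-≤ 2 (*-monoʳ-≤ 2 (s≤s F≤)) ⟩
    2 * suc (A + (suc b + (2 + 2 * b + (D + K)))) + 2
      ≡⟨ eq₁ A b D K ⟩
    2 * suc A + (2 * K + (2 * D + (6 * b + 8)))
      ≤⟨ +-mono-≤ (*-monoʳ-≤ 2 A<d) (+-monoˡ-≤ (2 * D + (6 * b + 8)) K≤) ⟩
    2 * d + (suc (M + D′) + (2 * D + (6 * b + 8)))
      ≡⟨ eq₂ d D′ D b ⟩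
    2 * d + (D + D′) + D + (12 * b + 14)
      ≤⟨ +-monoˡ-≤ (12 * b + 14) (+-mono-≤ (+-monoʳ-≤ (2 * d) D+D′≤) D≤) ⟩
    2 * d + d + suc b + (12 * b + 14)
      ≡⟨ eq₃ d b ⟩
    3 * d + (13 * b + 15)
      ≤⟨ +-mono-≤ (*-monoʳ-≤ 3 d≤) (+-monoˡ-≤ 15 (*-monoˡ-≤ b (m≤n+m 13 2))) ⟩
    3 * Δ + (15 * b + 15)
      ≡⟨ cong (3 * Δ +_) (eq₄ b) ⟩
    3 * Δ + 15 * suc b ∎
    where
    open ≤-Reasoning
    eq₁ : ∀ A b D K → 2 * suc (A + (suc b + (2 + 2 * b + (D + K)))) + 2 ≡ 2 * suc A + (2 * K + (2 * D + (6 * b + 8)))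
    eq₁ = solve-∀
    eq₂ : ∀ d D′ D b → 2 * d + (suc (5 + 6 * b + D′) + (2 * D + (6 * b + 8))) ≡ 2 * d + (D + D′) + D + (12 * b + 14)
    eq₂ = solve-∀
    eq₃ : ∀ d b → 2 * d + d + suc b + (12 * b + 14) ≡ 3 * d + (13 * b + 15)
    eq₃ = solve-∀
    eq₄ : ∀ b → 15 * b + 15 ≡ 15 * suc b
    eq₄ = solve-∀

  #far : ∀ {c m e j x p} → Inv c m e j → (∀ v → e v ≤ 1) → arc x p ≡ true → at c down x p ≡ nothing →
         # (far c x p) < k
  #far {c} {m} {e} {j} {x} {p} I e≤1 xp free = enough (suc (# (far c x p)))
    (far-arithmetic {# (far c x p)} far≤ around< palette≤
      (#-⊎ (λ t → arc⇒adj) (λ s → arc⇒adj′) (λ t → arc-asym)) (outdegree p) (degree≤Δ p))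
    where
    children≤ : # (fromChildren c down x) ≤ 2 + 2 * b
    children≤ = ≤-trans (#fromChildren (balanced I) down x)
      (≤-trans (m≤n+m (below m down x) (below m up x)) (load-down (balanced I) e≤1 (p , xp , free)))
    far≤ : # (far c x p) ≤ # (aroundBut c p x) + (suc b + (2 + 2 * b + (# (λ t → arc p t) + # (palette c p))))
    far≤ = #-∪≤ _ _ ≤-refl (#-∪≤ _ _ (≤-trans (#-image≤ _ _) (outdegree x))
             (#-∪≤ _ _ children≤ (#-∪≤ _ _ (#-image≤ _ _) ≤-refl)))
    around< : # (aroundBut c p x) < # (λ t → adj G p t)
    around< = ≤-trans (s≤s (#-image≤ _ _)) (but-strict (arc⇒adj′ xp))
    -- `always` is the field to use, because every (s , sp) may already be coloured.
    palette≤ : 2 * # (palette c p) ≤ suc (M + # (λ s → arc s p))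
    palette≤ = ≤-trans (always (frugal I) p) (s≤s (+-monoʳ-≤ M (#-mono (λ s → proj₁ ∘ ∧-true⁻))))

  -- A fresh colour for an up incidence meets at most M - 1 colours near `x` and Δ around `p`, so a
  -- single Δ is spent.
  #near∪around : ∀ {c m e j x p} → Inv c m e j → (∀ v → e v ≤ 1) → arc x p ≡ true → at c up x p ≡ nothing →
                 # (near c x p ∪ around c p) < k
  #near∪around {c} {x = x} {p} I e≤1 xp free = enough _ (begin
    2 * suc (# (near c x p ∪ around c p)) + 2
      ≤⟨ +-monoˡ-≤ 2 (*-monoʳ-≤ 2 (s≤s (#-∪≤ (near c x p) _ ≤-refl (≤-trans (#-image≤ _ _) (degree≤Δ p))))) ⟩
    2 * (suc (# (near c x p)) + maxDegree G) + 2
      ≤⟨ +-monoˡ-≤ 2 (*-monoʳ-≤ 2 (+-monoˡ-≤ (maxDegree G) (#near (balanced I) e≤1 xp free))) ⟩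
    2 * (M + maxDegree G) + 2
      ≡⟨ eq (maxDegree G) b ⟩
    2 * maxDegree G + (12 * b + 12)
      ≤⟨ +-mono-≤ (*-monoˡ-≤ (maxDegree G) (n≤1+n 2)) (+-mono-≤ (*-monoˡ-≤ b (m≤n+m 12 3)) (m≤n+m 12 3)) ⟩
    3 * maxDegree G + (15 * b + 15)
      ≡⟨ cong (3 * maxDegree G +_) (eq′ b) ⟩
    3 * maxDegree G + 15 * suc b ∎)
    where
    open ≤-Reasoning
    eq : ∀ Δ b → 2 * (5 + 6 * b + Δ) + 2 ≡ 2 * Δ + (12 * b + 12)
    eq = solve-∀
    eq′ : ∀ b → 15 * b + 15 ≡ 15 * suc b
    eq′ = solve-∀

  -- The last component records that a palette of at least `M` colours is never enlarged: a colour
  -- of it outside `near` exists, and `Proper` keeps that colour off the incidences (p , pt).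
  legalColour : ∀ {c m e j} κ {x p} → Inv c m e j → (∀ v → e v ≤ 1) → arc x p ≡ true → at c κ x p ≡ nothing →
                ∃ λ α → LegalAt c κ x p α × (κ ≡ up → M ≤ # (palette c p) → palette c p α ≡ true)
  legalColour down I e≤1 xp free =
    let α , ∉ = available (#far I e≤1 xp free) in α , down-legal xp ∉ , λ ()
  legalColour {c} up {x} {p} I e≤1 xp free = split (M ≤? # (palette c p))
    where
    split : Dec (M ≤ # (palette c p)) →
            ∃ λ α → LegalAt c up x p α × (up ≡ up → M ≤ # (palette c p) → palette c p α ≡ true)
    split (yes M≤) =
      let α , α∈ , ∉   = choose {P = near c x p} {Q = palette c p} (≤-trans (#near (balanced I) e≤1 xp free) M≤)
          s , sp , cs  = image⁻ (λ s → arc s p) (λ s → at c up s p) {α} α∈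
      in α , up-legal xp ∉ (λ t pt → proper I (arc⇒adj sp) pt cs) , λ _ _ → α∈
    split (no M≰) =
      let α , ∉ = available (#near∪around I e≤1 xp free)
      in α , up-legal xp (∉ ∘ ∪ˡ (near c x p) (around c p))
                      (λ t → avoid⁻ (∉ ∘ ∪ʳ (near c x p) (around c p)) t)
           , λ _ M≤ → contradiction M≤ M≰

  ¬Blocked : ∀ {c m e j} → Inv c m e j → (∀ v → e v ≤ 1) → ¬ Blocked c
  ¬Blocked I e≤1 (u , v , (uv , free) , stuck) with adj⇒arc uv
  ... | inj₁ u→v = let α , legal , _ = legalColour up I e≤1 u→v free in stuck α legal
  ... | inj₂ v→u = let α , legal , _ = legalColour down I e≤1 v→u free in stuck α legal

  -- Alice's reply

  Inc-at : ∀ κ {x p} → arc x p ≡ true → Inc (src κ x p) (dst κ x p)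
  Inc-at up   = arc⇒adj
  Inc-at down = arc⇒adj′

  -- Either nothing is left to colour, or a legal move restores the invariants with neither excess
  -- nor debt.
  Reply : Coloring → Set
  Reply c = Complete c ⊎ Σ V λ u → Σ V λ v → Σ (Fin k) λ α → Uncolored c u v × Legal c u v α ×
              ∃ λ m → Inv (update c u v α) m none none

  -- Colouring an up incidence below `p` can repay a palette debt at `p`; colouring a down incidence
  -- repays none.
  slack : Kind → V → V → ℕ
  slack up   p = δ p
  slack down p = none

  reply-at : ∀ {c m e j m′} κ {x p} → Inv c m e j → (∀ v → e v ≤ 1) → Frugal c (slack κ p) →
             arc x p ≡ true → at c κ x p ≡ nothing →
             (∀ α → Balanced (paint c κ x p α) m′ none) → Reply c
  reply-at {c} {m′ = m′} κ {x} {p} I e≤1 F xp free balanced′ =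
    let α , legal , reuse = legalColour κ I e≤1 xp free
    in inj₂ (src κ x p , dst κ x p , α , (Inc-at κ xp , free) , legal , m′ ,
             inv (balanced′ α) (frugal′ κ F free α reuse) (Proper-update (Inc-at κ xp) legal (proper I)))
    where
    frugal′ : ∀ κ → Frugal c (slack κ p) → at c κ x p ≡ nothing → ∀ α →
              (κ ≡ up → M ≤ # (palette c p) → palette c p α ≡ true) →
              Frugal (paint c κ x p α) none
    frugal′ up   F free α reuse = Frugal-reuse xp free (reuse refl) F
    frugal′ down F free α reuse = Frugal-paint-down xp F

  -- The measure that makes the climb terminate: every step marks something new.
  unmarked : Marks → ℕ
  unmarked m = size (λ x p → not (m up x p)) + size (λ x p → not (m down x p))

  unmarked-mark : ∀ m κ x p → m κ x p ≢ true → unmarked (mark m κ x p) < unmarked m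
  unmarked-mark m κ x p ¬mk = go κ ¬mk
    where
    shrinks : ∀ κ κ′ y q → not (mark m κ x p κ′ y q) ≡ true → not (m κ′ y q) ≡ true
    shrinks κ κ′ y q = not-antimono (mark-mono m κ x p)
    weak : ∀ κ κ′ → size (λ y q → not (mark m κ x p κ′ y q)) ≤ size (λ y q → not (m κ′ y q))
    weak κ κ′ = ∑-mono (λ y → #-mono (shrinks κ κ′ y))
    strict : ∀ κ → m κ x p ≢ true → size (λ y q → not (mark m κ x p κ y q)) < size (λ y q → not (m κ y q))
    strict κ ¬mk = size-strict x p (shrinks κ κ) (λ h → not-true h (mark-self m κ x p)) (not-false ¬mk)
    go : ∀ κ → m κ x p ≢ true → unmarked (mark m κ x p) < unmarked m
    go up   ¬mk = +-mono-<-≤ (strict up ¬mk) (weak up down)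
    go down ¬mk = +-mono-≤-< (weak down up) (strict down ¬mk)

  Unclosed : Coloring → V → Set
  Unclosed c v = Open c up v ⊎ Open c down v

  Unclosed? : ∀ c v → Dec (Unclosed c v)
  Unclosed? c v = Open? c up v ⊎-dec Open? c down v

  closed⇒¬Open : ∀ {c v} → ¬ Unclosed c v → ∀ κ → ¬ Open c κ v
  closed⇒¬Open ¬o up   = ¬o ∘ inj₁
  closed⇒¬Open ¬o down = ¬o ∘ inj₂

  all-closed⇒Complete : ∀ {c} → ¬ ∃ (Unclosed c) → Complete c
  all-closed⇒Complete ¬o u v uv free with adj⇒arc uv
  ... | inj₁ u→v = ¬o (u , inj₁ (v , u→v , free))
  ... | inj₂ v→u = ¬o (v , inj₂ (u , v→u , free))

  -- Lets a free move start a climb at any vertex, as if it had just been reached.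
  Inv-excess : ∀ {c m j} v → Inv c m none j → Inv c m (δ v) j
  Inv-excess v I = inv (Balanced-weaken (λ _ → z≤n) (balanced I)) (frugal I) (proper I)

  priority : ∀ c {v} → Unclosed c v → ∃ λ κ → Open c κ v × First c κ v
  priority c {v} (inj₂ o) = down , o , λ ()
  priority c {v} (inj₁ o) with Open? c down v
  ... | yes o′ = down , o′ , λ ()
  ... | no ¬o′ = up , o , λ _ → ¬o′

  mutual

    advance : ∀ fuel {c m} v → unmarked m ≤ fuel → Inv c m (δ v) none → Unclosed c v → Reply c
    advance fuel {c} {m} v ≤fuel I o =
      let κ , (p , vp , free) , first = priority c o
      in step fuel κ ≤fuel I vp free first (m κ v p Bool.≟ true)

    step : ∀ fuel {c m} κ {v p} → unmarked m ≤ fuel → Inv c m (δ v) none → arc v p ≡ true →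
           at c κ v p ≡ nothing → First c κ v → Dec (m κ v p ≡ true) → Reply c
    step fuel κ {v} {p} ≤fuel I vp free first (yes mk) =
      reply-at κ I (δ≤1 v) (Frugal-weaken (slack κ p) (frugal I)) vp free
        (λ α → Balanced-paint-gain α vp mk free first (balanced I))
    step zero {m = m} κ {v} {p} ≤fuel I vp free first (no ¬mk) =
      contradiction (≤-trans (unmarked-mark m κ v p ¬mk) ≤fuel) n≮0
    step (suc fuel) {m = m} κ {v} {p} ≤fuel I vp free first (no ¬mk) =
      climb fuel p (s≤s⁻¹ (≤-trans (unmarked-mark m κ v p ¬mk) ≤fuel))
        (inv (Balanced-mark κ v p vp ¬mk first (balanced I)) (frugal I) (proper I))

    climb : ∀ fuel {c m} v → unmarked m ≤ fuel → Inv c m (δ v) none → Reply c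
    climb fuel {c} v ≤fuel I with Unclosed? c v
    ... | yes o = advance fuel v ≤fuel I o
    -- The climb has reached a vertex with nothing left to colour, where the excess is harmless, so
    -- Alice may continue anywhere.
    ... | no ¬o = freeMove fuel ≤fuel (inv (Balanced-closed (closed⇒¬Open {c} ¬o) (balanced I)) (frugal I) (proper I))

    freeMove : ∀ fuel {c m} → unmarked m ≤ fuel → Inv c m none none → Reply c
    freeMove fuel {c} ≤fuel I with any? (Unclosed? c)
    ... | yes (v , o) = advance fuel v ≤fuel (Inv-excess v I) o
    ... | no ¬o       = inj₁ (all-closed⇒Complete ¬o)

  -- With more than M colours below p nothing charged to p is uncoloured, so no climb from p is needed.
  reuse-or-climb : ∀ {c m} p → Inv c m (δ p) (δ p) → Reply c
  reuse-or-climb {c} {m} p I = split (# (palette c p) ≤? M)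
    where
    split : Dec (# (palette c p) ≤ M) → Reply c
    split (yes small) = climb _ p ≤-refl (inv (balanced I) (Frugal-small small (frugal I)) (proper I))
    split (no ¬small) = refill (any? λ s → (arc s p Bool.≟ true) ×-dec maybe-≡-dec _≟_ (at c up s p) nothing)
      where
      closed : ∀ κ → ¬ Open c κ p
      closed = crowded⇒closed (balanced I) (δ≤1 p) (≰⇒> ¬small)
      B : Balanced c m none
      B = Balanced-closed closed (balanced I)
      refill : Dec (∃ λ s → arc s p ≡ true × at c up s p ≡ nothing) → Reply c
      -- No child of `p` is left to reuse a colour, but then `unfilled` is vacuous at `p` and the
      -- debt needs no repayment.
      refill (no ¬s) = freeMove _ ≤-refl
        (inv B (Frugal-full (λ s sp free → ¬s (s , sp , free)) (frugal I)) (proper I))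
      -- The unpaid mark on (s , sp) adds load only at `p`, which is closed.
      refill (yes (s , sp , free)) = reply-at up I (δ≤1 p) (frugal I) sp free
        (λ α → Balanced-paint α sp (mark-self m up s p) (Balanced-closed closed (Balanced-touch up s p B)))

  -- The course of the game

  AlicePosition : Coloring → Set
  AlicePosition c = ¬ Blocked c × Reply c

  after-Bob : ∀ {c m} κ {x p α} → Inv c m none none → arc x p ≡ true → at c κ x p ≡ nothing →
              LegalAt c κ x p α → AlicePosition (paint c κ x p α)
  after-Bob {c} {m} κ {x} {p} {α} I xp free legal = go κ free legal
    where
    -- Bob's incidence is marked without credit, which creates the excess at `p`.
    balanced′ : ∀ κ → Balanced (paint c κ x p α) (mark m κ x p) (δ p)
    balanced′ κ = Balanced-paint α xp (mark-self m κ x p) (Balanced-touch κ x p (balanced I))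
    go : ∀ κ → at c κ x p ≡ nothing → LegalAt c κ x p α → AlicePosition (paint c κ x p α)
    go down free legal = ¬Blocked I′ (δ≤1 p) , climb _ p ≤-refl I′
      where
      I′ : Inv (paint c down x p α) (mark m down x p) (δ p) none
      I′ = inv (balanced′ down) (Frugal-paint-down xp (frugal I)) (Proper-update (arc⇒adj′ xp) legal (proper I))
    -- An up move may also add a colour to the palette of `p`, so here a debt accompanies the
    -- excess.
    go up   free legal = ¬Blocked I′ (δ≤1 p) , reuse-or-climb p I′
      where
      I′ : Inv (paint c up x p α) (mark m up x p) (δ p) (δ p)
      I′ = inv (balanced′ up) (Frugal-any xp free (frugal I)) (Proper-update (arc⇒adj xp) legal (proper I))

  Bob-move : ∀ {c m u v α} → Inv c m none none → Uncolored c u v → Legal c u v α → AlicePosition (update c u v α)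
  Bob-move I (uv , free) legal with adj⇒arc uv
  ... | inj₁ u→v = after-Bob up I u→v free legal
  ... | inj₂ v→u = after-Bob down I v→u free legal

  -- Counts all ordered pairs, adjacent or not; as fuel it only has to drop with each move.
  uncoloured : Coloring → ℕ
  uncoloured c = size (λ u v → not (is-just (c u v)))

  uncoloured-update : ∀ {c u v α} → c u v ≡ nothing → uncoloured (update c u v α) < uncoloured c
  uncoloured-update {c} {u} {v} {α} free = size-strict u v shrinks
    (λ h → case trans (sym h) (cong (not ∘ is-just) (update-self c u v α)) of λ ())
    (cong (not ∘ is-just) free)
    where
    shrinks : ∀ x y → not (is-just (update c u v α x y)) ≡ true → not (is-just (c x y)) ≡ true
    shrinks x y = not-antimono (update-is-just c u v α)

  mutual

    Alice-wins : ∀ fuel {c} → uncoloured c ≤ fuel → AlicePosition c → AliceWins c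
    Alice-wins fuel ≤fuel (_ , inj₁ complete) = finished complete
    Alice-wins zero ≤fuel (_ , inj₂ (u , v , α , (uv , free) , _)) =
      contradiction (≤-trans (uncoloured-update {α = α} free) ≤fuel) n≮0
    Alice-wins (suc fuel) ≤fuel (¬blocked , inj₂ (u , v , α , (uv , free) , legal , m , I)) =
      move ¬blocked u v α (uv , free) legal
        (Bob-loses fuel (s≤s⁻¹ (≤-trans (uncoloured-update free) ≤fuel)) I)

    Bob-loses : ∀ fuel {c m} → uncoloured c ≤ fuel → Inv c m none none → BobMoveWins c
    Bob-loses fuel ≤fuel I = respond (¬Blocked I none≤1) λ u v α (uv , free) legal →
      Alice-wins fuel (≤-trans (<⇒≤ (uncoloured-update free)) ≤fuel) (Bob-move I (uv , free) legal)

  Inv-empty : Inv empty (λ _ _ _ → false) none none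
  Inv-empty = inv
    (record { coloured⇒marked = λ _ () ; load≤ = λ {κ} {x} _ _ → ≤-trans (load-empty x) z≤n })
    (record { always = λ v → ≤-trans (palette-empty v) z≤n ; unfilled = λ {s} {v} _ _ → ≤-trans (palette-empty v) z≤n })
    (λ _ _ ())
    where
    open ≤-Reasoning
    below-empty : ∀ κ x → below (λ _ _ _ → false) κ x ≤ 0
    below-empty κ x = ≤-trans (#-mono {Q = λ _ → false} (λ y → proj₂ ∘ ∧-true⁻)) (≤-reflexive (#-none (n G)))
    load-empty : ∀ x → load (λ _ _ _ → false) x ≤ 0
    load-empty x = +-mono-≤ (below-empty up x) (below-empty down x)
    palette-empty : ∀ v → 2 * # (palette empty v) ≤ 0
    palette-empty v = *-monoʳ-≤ 2 (≤-trans (#palette≤received empty v)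
      (≤-trans (#-mono {Q = λ _ → false} (λ y → proj₂ ∘ ∧-true⁻)) (≤-reflexive (#-none (n G)))))

  Alice-wins-empty : AliceWins empty
  Alice-wins-empty = Alice-wins _ ≤-refl (¬Blocked Inv-empty none≤1 , freeMove _ ≤-refl Inv-empty)

-- The numerical bound

enoughColours : ∀ Δ a s → 2 * s + 2 ≤ 3 * Δ + 15 * a → s ≤ (3 * Δ ∸ a) / 2 + 8 * a ∸ 1
enoughColours Δ a s h = m+n≤o⇒m≤o∸n s (begin
  s + 1                              ≡⟨ m*n/n≡m (s + 1) 2 ⟨
  (s + 1) * 2 / 2                    ≤⟨ /-monoˡ-≤ 2 twice ⟩
  (3 * Δ ∸ a + 8 * a * 2) / 2        ≡⟨ +-distrib-/-∣ʳ (3 * Δ ∸ a) (n∣m*n (8 * a)) ⟩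
  (3 * Δ ∸ a) / 2 + 8 * a * 2 / 2    ≡⟨ cong ((3 * Δ ∸ a) / 2 +_) (m*n/n≡m (8 * a) 2) ⟩
  (3 * Δ ∸ a) / 2 + 8 * a            ∎)
  where
  open ≤-Reasoning
  eq₁ : ∀ s → (s + 1) * 2 ≡ 2 * s + 2
  eq₁ = solve-∀
  eq₂ : ∀ a d → a + d + 15 * a ≡ d + 8 * a * 2
  eq₂ = solve-∀
  twice : (s + 1) * 2 ≤ 3 * Δ ∸ a + 8 * a * 2
  twice = begin
    (s + 1) * 2                 ≡⟨ eq₁ s ⟩
    2 * s + 2                   ≤⟨ h ⟩
    -- This holds also when `a` exceeds `3 * Δ` and the subtraction is truncated.
    3 * Δ + 15 * a              ≤⟨ +-monoˡ-≤ (15 * a) (m≤n+m∸n (3 * Δ) a) ⟩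
    a + (3 * Δ ∸ a) + 15 * a    ≡⟨ eq₂ a (3 * Δ ∸ a) ⟩
    3 * Δ ∸ a + 8 * a * 2       ∎

theorem2 : (G : Graph) (a : ℕ) → IsArboricity G a →
    Σ ℕ λ k → (k ≤ ((3 * maxDegree G ∸ a) / 2 + 8 * a ∸ 1)) × AliceHasWinningStrategy G k
-- A partition into no forests maps every pair of vertices into `Fin 0`, so the graph has no
-- vertices and the empty colouring is complete.
theorem2 G zero    ((col , _) , _) = _ , ≤-refl , Game.finished (λ u v _ _ → case col u v of λ ())
theorem2 G (suc b) (forests , _)   = _ , ≤-refl ,
  Strategy.Alice-wins-empty G b _ (forests⇒orientation G forests) (enoughColours (maxDegree G) (suc b))
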